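{- Let $k\ge1$ and $n\ge1$. The descending strictly $k$-Naples parking functions of length $n$ are in bijection with the $(2k+2)$-in-$(n+k+1)$ dissections, taken up to rotation, together with a distinguished edge of the $(2k+2)$-gon.
   Context: An $r$-in-$s$ dissection is a dissection of a convex $s$-gon, by non-crossing diagonals, into one $r$-gon and $s-r$ triangles. Here one considers pairs consisting of a $(2k+2)$-in-$(n+k+1)$ dissection and a distinguished edge of its $(2k+2)$-gon, with two such pairs identified if one is obtained from the other by a rotation of the $(n+k+1)$-gon. Parking rules: $n$ spots $1,\dots,n$; cars $c_1,\dots,c_n$ arrive in order with preferences $a_j\in[n]$; $k$-Naples rule: $c_j$ parks at $a_j$ if empty, otherwise checks spots $a_j-1,\dots,a_j-k$ (those $\ge1$) in order and parks in the first empty one, otherwise drives forward from $a_j$ and parks in the first empty spot after $a_j$ (failing if none). A preference is $k$-Naples if all cars park ($0$-Naples = ordinary parking functions), and strictly $k$-Naples if it is $k$-Naples but not $(k-1)$-Naples. Descending means weakly decreasing. -}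

module Defs where

open import Data.Nat using (ℕ; zero; suc; _+_; _*_; _∸_; _≤_; _<_; _≡ᵇ_; _<ᵇ_)
open import Data.Nat.DivMod using (_%_; m%n<n)
open import Data.Bool using (Bool; true; false; T; if_then_else_; not; _∧_)
open import Data.Fin using (Fin; toℕ; fromℕ<)
open import Data.Fin.Subset using (Subset; _∈_; ∣_∣)
open import Data.Vec using (Vec; lookup; toList)
open import Data.List using (List; []; _∷_; filterᵇ; upTo; map)
open import Data.Bool.ListAction using (any)
open import Data.Maybe using (Maybe; just; nothing; is-just; _>>=_)
open import Data.Product using (Σ; ∃; _×_; _,_; proj₁)
open import Data.Sum using (_⊎_)
open import Relation.Binary.PropositionalEquality using (_≡_; _≢_)
open import Relation.Nullary using (¬_)

-- Parking.  Spots are 0-indexed: spot s here is spot s+1 of the paper,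
-- preferences are elements of Fin n.

free : List ℕ → ℕ → Bool
free occ s = not (any (λ o → o ≡ᵇ s) occ)

backward : ℕ → ℕ → List ℕ → Maybe ℕ
backward zero    a       occ = nothing
backward (suc i) zero    occ = nothing
backward (suc i) (suc b) occ = if free occ b then just b else backward i b occ

forward : ℕ → ℕ → List ℕ → Maybe ℕ
forward n a occ with filterᵇ (λ s → (a <ᵇ s) ∧ free occ s) (upTo n)
... | []    = nothing
... | s ∷ _ = just s

parkCar : ℕ → ℕ → List ℕ → ℕ → Maybe ℕ
parkCar k n occ a with free occ a
... | true  = just a
... | false with backward k a occ
...   | just s  = just s
...   | nothing = forward n a occ

parkAll : ℕ → ℕ → List ℕ → List ℕ → Maybe (List ℕ)
parkAll k n occ []       = just occ
parkAll k n occ (a ∷ as) = parkCar k n occ a >>= λ s → parkAll k n (s ∷ occ) as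

IsNaples : ℕ → (n : ℕ) → Vec (Fin n) n → Set
IsNaples k n a = T (is-just (parkAll k n [] (map toℕ (toList a))))

IsStrictlyNaples : ℕ → (n : ℕ) → Vec (Fin n) n → Set
IsStrictlyNaples k n a = IsNaples k n a × ¬ IsNaples (k ∸ 1) n a

Descending : {n : ℕ} → Vec (Fin n) n → Set
Descending {n} a = (i j : Fin n) → toℕ i ≤ toℕ j → toℕ (lookup a j) ≤ toℕ (lookup a i)

DescStrictNaples : ℕ → ℕ → Set
DescStrictNaples k n = Σ (Vec (Fin n) n) λ a → Descending a × IsStrictlyNaples k n a

-- Dissections of a convex m-gon with vertices 0,1,...,m-1 in cyclic order.

Side : {m : ℕ} → Fin m → Fin m → Set
Side {m} i j = (toℕ j ≡ suc (toℕ i)) ⊎ (toℕ i ≡ suc (toℕ j))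
             ⊎ (toℕ i ≡ 0 × suc (toℕ j) ≡ m) ⊎ (toℕ j ≡ 0 × suc (toℕ i) ≡ m)

Diagonal : {m : ℕ} → Fin m → Fin m → Set
Diagonal i j = (toℕ i ≢ toℕ j) × ¬ Side i j

Cross : {m : ℕ} → Fin m → Fin m → Fin m → Fin m → Set
Cross a b c d = toℕ a < toℕ c × toℕ c < toℕ b × toℕ b < toℕ d

record Dissection (m : ℕ) : Set where
  field
    D        : Fin m → Fin m → Bool
    D-sym    : ∀ i j → D i j ≡ D j i
    D-diag   : ∀ i j → T (D i j) → Diagonal i j
    D-noncr  : ∀ a b c d → T (D a b) → T (D c d) → ¬ Cross a b c d
open Dissection public

Edge : {m : ℕ} → Dissection m → Fin m → Fin m → Set
Edge Δ i j = Side i j ⊎ T (D Δ i j)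

-- a < b are cyclically consecutive elements of the vertex set S
ConsecIn : {m : ℕ} → Subset m → Fin m → Fin m → Set
ConsecIn {m} S a b = a ∈ S × b ∈ S × toℕ a < toℕ b ×
  ( (∀ (c : Fin m) → c ∈ S → ¬ (toℕ a < toℕ c × toℕ c < toℕ b))
  ⊎ (∀ (c : Fin m) → c ∈ S → toℕ a ≤ toℕ c × toℕ c ≤ toℕ b))

-- S is (the vertex set of) a face (region) of the dissection: a polygon
-- with at least 3 vertices whose sides are edges of the dissection and
-- which is not cut by any chosen diagonal
Face : {m : ℕ} → Dissection m → Subset m → Set
Face {m} Δ S = 3 ≤ ∣ S ∣
  × (∀ a b → ConsecIn S a b → Edge Δ a b)
  × (∀ (a b : Fin m) → a ∈ S → b ∈ S → toℕ a < toℕ b → T (D Δ a b) → ConsecIn S a b)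

record MarkedDiss (r m : ℕ) : Set where
  field
    diss     : Dissection m
    rgon     : Subset m
    rgon-face : Face diss rgon
    rgon-size : ∣ rgon ∣ ≡ r
    others   : ∀ S → Face diss S → ∣ S ∣ ≡ 3 ⊎ S ≡ rgon
    e₁ e₂    : Fin m
    edge     : ConsecIn rgon e₁ e₂
open MarkedDiss public

rot : {m : ℕ} → Fin m → Fin m
rot {suc m} i = fromℕ< (m%n<n (suc (toℕ i)) (suc m))

rotBy : {m : ℕ} → ℕ → Fin m → Fin m
rotBy zero    i = i
rotBy (suc t) i = rot (rotBy t i)

SamePair : {m : ℕ} → Fin m → Fin m → Fin m → Fin m → Set
SamePair a b c d = (a ≡ c × b ≡ d) ⊎ (a ≡ d × b ≡ c)

_≈rot_ : {r m : ℕ} → MarkedDiss r m → MarkedDiss r m → Set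
_≈rot_ {r} {m} X Y = ∃ λ (t : ℕ) →
  (∀ i j → D (diss Y) (rotBy t i) (rotBy t j) ≡ D (diss X) i j)
  × SamePair (rotBy t (e₁ X)) (rotBy t (e₂ X)) (e₁ Y) (e₂ Y)

-- A descending preference is k-Naples exactly when a_j + j < n + k for all (0-based) j.  Write it as the word
-- with a letter E for each car and a letter N for each unit by which the preference decreases from n − 1 to 0:
-- the condition says that no prefix has more than k + 1 letters E in excess of its letters N.  Matching every
-- N with a later E gives a unique factorisation D₁ E D₂ E … E D N D … N D in which each D is a balanced word,
-- i.e. a binary tree, and the number p of unmatched E is the largest excess.  Strictly k-Naples means p = k + 1,
-- hence k unmatched N, and so such preferences are sequences of 2k + 2 binary trees with n − k − 1 nodes in all.
--
-- Rotate a marked dissection so that the marked edge is {0, b} and the (2k+2)-gon lies on the vertices 0, …, b.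
-- It arises from a triangulation of the (n+k+1)-gon by deleting the chords at 0 that are interior to the
-- (2k+2)-gon.  The triangulation is a binary tree with n + k leaves, its chords at 0 are the left spine, and
-- cutting off what hangs from the spine gives back 2k + 2 trees; the part above {0, b} counts as one of them.

module Submission where

open import Defs
open import Data.Nat
open import Data.Nat.Properties
open import Data.Nat.DivMod using (_%_; m<n⇒m%n≡m; n%n≡0; m%n<n; %-distribˡ-+; m%n%n≡m%n; m≤n⇒[n∸m]%m≡n%m)
open import Data.Nat.ListAction using (sum)
open import Data.Nat.Solver using (module +-*-Solver)
open import Data.Bool using (true; false; T; _∧_; T?)
open import Data.Bool.Properties using (T-∧; T-≡)
open import Data.Fin using (Fin; zero; suc; toℕ; fromℕ<; fromℕ; inject₁)
open import Data.Fin.Properties using (any?; all?)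
import Data.Fin.Properties as Fin
open import Data.Fin.Subset using (Subset; _∈_; _∉_; _⊆_; ∣_∣; inside; outside)
open import Data.Fin.Subset.Properties using (_∈?_; ⊆-antisym)
open import Data.Vec using (Vec; []; _∷_; lookup; toList; tabulate; _∷ʳ_; initLast; here; there)
open import Data.Vec.Properties using (length-toList; lookup⇒[]=; []=⇒lookup; lookup∘tabulate)
open import Data.List using (List; []; _∷_; length; map; _++_; applyUpTo; filterᵇ; upTo)
open import Data.List.Properties using (length-++; length-map; length-applyUpTo)
import Data.List.Properties as List
import Data.List.Membership.Propositional as List
open import Data.List.Membership.Propositional.Properties
  using (∈-∃++; ∈-++⁺ˡ; ∈-++⁺ʳ; ∈-++⁻; ∈-map⁺; ∈-map⁻; ∈-applyUpTo⁺; ∈-applyUpTo⁻; ∈-upTo⁺; ∈-upTo⁻; ∈-filter⁺; ∈-filter⁻)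
open import Data.List.Relation.Unary.Any using (here; there)
open import Data.List.Relation.Unary.All as All using (All; []; _∷_)
open import Data.List.Relation.Unary.AllPairs using ([]; _∷_)
open import Data.List.Relation.Unary.Unique.Propositional using (Unique)
import Data.List.Relation.Unary.Unique.Propositional.Properties as Unique
open import Data.Maybe using (just; nothing; is-just)
open import Data.Product using (Σ; ∃; _×_; _,_; proj₁; proj₂)
open import Data.Sum using (_⊎_; inj₁; inj₂; [_,_]′)
open import Data.Unit using (⊤; tt)
open import Function using (_∘_)
open import Function.Bundles using (Equivalence)
open import Relation.Nullary using (¬_; Dec; yes; no; contradiction; does)
open import Relation.Nullary.Decidable
  using (_×-dec_; _⊎-dec_; _→-dec_; ¬?; dec-true; map′; ⌊_⌋; toWitness; fromWitness)
open import Relation.Binary.Definitions using (tri<; tri≈; tri>)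
open import Relation.Binary.PropositionalEquality hiding ([_])

-- Why the sizes fit: a side of the (2k+2)-gon carries a tree, with one leaf more than nodes, but
-- beyond the marked side lies a possibly empty list of trees. Reading that list as the right spine
-- of a single tree turns its total of leaves into a number of nodes. So 2k + 1 trees contribute
-- their nodes plus one and the last only its nodes, and n - k - 1 nodes give n + k leaves. Two
-- obstacles shape the dissection side. `MarkedDiss` offers diagonals and vertex sets, no recursive
-- structure. It becomes a tree because a face is determined by its smallest and largest vertex and
-- every edge with vertices between its ends has a face under it. And dissections are compared up to
-- rotation. A rotation between two canonical forms preserves the marked edge up to swapping its
-- ends; a swap would carry the polygon to the wrong side of that edge, so the rotation fixes 0 and
-- is the identity. Here k ≥ 1 matters: with at least four vertices the polygon is recognised from
-- the diagonals alone.

unique-⊆⇒length≤ : {A : Set} {xs ys : List A} → Unique xs →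
  (∀ {x} → x List.∈ xs → x List.∈ ys) → length xs ≤ length ys
unique-⊆⇒length≤ [] _ = z≤n
unique-⊆⇒length≤ {A} {x ∷ xs} (x≢ ∷ u) sub with ∈-∃++ (sub (here refl))
... | us , vs , refl = begin
    suc (length xs)               ≤⟨ s≤s (unique-⊆⇒length≤ u sub′) ⟩
    suc (length (us ++ vs))       ≡⟨ cong suc (length-++ us) ⟩
    suc (length us + length vs)   ≡⟨ +-suc (length us) (length vs) ⟨
    length us + suc (length vs)   ≡⟨ length-++ us ⟨
    length (us ++ x ∷ vs)        ∎
  where
  open ≤-Reasoning
  sub′ : ∀ {y} → y List.∈ xs → y List.∈ us ++ vs
  sub′ y∈ with ∈-++⁻ us (sub (there y∈))
  ... | inj₁ p = ∈-++⁺ˡ p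
  ... | inj₂ (here refl) = contradiction refl (All.lookup x≢ y∈)
  ... | inj₂ (there p) = ∈-++⁺ʳ us p

-- Sizes of subsets, by listing their elements

elements : ∀ {n} → Subset n → List (Fin n)
elements [] = []
elements (inside ∷ S) = zero ∷ map suc (elements S)
elements (outside ∷ S) = map suc (elements S)

length-elements : ∀ {n} (S : Subset n) → length (elements S) ≡ ∣ S ∣
length-elements [] = refl
length-elements (inside ∷ S) = cong suc (trans (length-map suc (elements S)) (length-elements S))
length-elements (outside ∷ S) = trans (length-map suc (elements S)) (length-elements S)

zero∉map-suc : ∀ {n} (xs : List (Fin n)) {x : Fin (suc n)} → x List.∈ map suc xs → zero ≢ x
zero∉map-suc xs p refl with ∈-map⁻ suc p
... | _ , _ , ()

elements-unique : ∀ {n} (S : Subset n) → Unique (elements S)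
elements-unique [] = []
elements-unique (inside ∷ S) =
  All.tabulate (zero∉map-suc (elements S)) ∷ Unique.map⁺ Fin.suc-injective (elements-unique S)
elements-unique (outside ∷ S) = Unique.map⁺ Fin.suc-injective (elements-unique S)

∈-elements⁺ : ∀ {n} {S : Subset n} {x} → x ∈ S → x List.∈ elements S
∈-elements⁺ {S = inside ∷ S} here = here refl
∈-elements⁺ {S = inside ∷ S} (there p) = there (∈-map⁺ suc (∈-elements⁺ p))
∈-elements⁺ {S = outside ∷ S} (there p) = ∈-map⁺ suc (∈-elements⁺ p)

∈-elements⁻ : ∀ {n} {S : Subset n} {x} → x List.∈ elements S → x ∈ S
∈-elements⁻ {S = inside ∷ S} (here refl) = here
∈-elements⁻ {S = inside ∷ S} (there p) with ∈-map⁻ suc p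
... | _ , q , refl = there (∈-elements⁻ q)
∈-elements⁻ {S = outside ∷ S} p with ∈-map⁻ suc p
... | _ , q , refl = there (∈-elements⁻ q)

unique⇒length≤∣∣ : ∀ {n} {S : Subset n} {xs} → Unique xs → All (_∈ S) xs → length xs ≤ ∣ S ∣
unique⇒length≤∣∣ {S = S} {xs} u a = subst (length xs ≤_) (length-elements S)
  (unique-⊆⇒length≤ u (λ p → ∈-elements⁺ (All.lookup a p)))

covered⇒∣∣≤length : ∀ {n} {S : Subset n} {xs} → (∀ {x} → x ∈ S → x List.∈ xs) → ∣ S ∣ ≤ length xs
covered⇒∣∣≤length {S = S} {xs} c = subst (_≤ length xs) (length-elements S)
  (unique-⊆⇒length≤ (elements-unique S) (λ p → c (∈-elements⁻ p)))

-- Parking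

interval : ℕ → ℕ → List ℕ
interval lo n = applyUpTo (lo +_) (n ∸ lo)

interval-unique : ∀ lo n → Unique (interval lo n)
interval-unique lo n = Unique.applyUpTo⁺₁ (lo +_) (n ∸ lo)
  (λ i<j _ eq → <⇒≢ i<j (+-cancelˡ-≡ lo _ _ eq))

∈-interval⁺ : ∀ {lo n x} → lo ≤ x → x < n → x List.∈ interval lo n
∈-interval⁺ {lo} {n} {x} lo≤x x<n = subst (List._∈ interval lo n) (m+[n∸m]≡n lo≤x)
  (∈-applyUpTo⁺ (lo +_) (∸-monoˡ-< x<n lo≤x))

∈-interval⁻ : ∀ {lo n x} → x List.∈ interval lo n → lo ≤ x × x < n
∈-interval⁻ {lo} {n} p with ∈-applyUpTo⁻ (lo +_) p
... | i , i<n∸lo , refl = m≤m+n lo i ,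
  subst (_≤ n) (cong suc (+-comm i lo)) (m≤o∸n⇒m+n≤o (suc i) lo≤n i<n∸lo)
  where
  lo≤n : lo ≤ n
  lo≤n = <⇒≤ (m∸n≢0⇒n<m (λ eq → n≮0 (subst (i <_) eq i<n∸lo)))

free⇒∉ : ∀ occ {s} → free occ s ≡ true → s List.∉ occ
free⇒∉ (o ∷ occ) {s} eq p with o ≡ᵇ s in e
free⇒∉ (o ∷ occ) {s} eq (here refl) | false = subst T e (≡⇒≡ᵇ s s refl)
free⇒∉ (o ∷ occ) {s} eq (there p) | false = free⇒∉ occ eq p

¬free⇒∈ : ∀ occ {s} → free occ s ≡ false → s List.∈ occ
¬free⇒∈ (o ∷ occ) {s} eq with o ≡ᵇ s in e
... | true = here (sym (≡ᵇ⇒≡ o s (subst T (sym e) tt)))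
... | false = there (¬free⇒∈ occ eq)

backward-just : ∀ k a occ {s} → backward k a occ ≡ just s → s List.∉ occ × s < a × a ≤ s + k
backward-just (suc i) (suc b) occ eq with free occ b in e
backward-just (suc i) (suc b) occ refl | true =
  free⇒∉ occ e , ≤-refl , subst (suc b ≤_) (sym (+-suc b i)) (s≤s (m≤m+n b i))
backward-just (suc i) (suc b) occ {s} eq | false with backward-just i b occ eq
... | s∉ , s<b , b≤ = s∉ , m<n⇒m<1+n s<b , subst (suc b ≤_) (sym (+-suc s i)) (s≤s b≤)

backward-nothing : ∀ k a occ → backward k a occ ≡ nothing → ∀ {s} → s < a → a ≤ s + k → s List.∈ occ
backward-nothing zero a occ eq {s} s<a a≤ = contradiction (subst (a ≤_) (+-identityʳ s) a≤) (<⇒≱ s<a)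
backward-nothing (suc i) (suc b) occ eq {s} (s≤s s≤b) a≤ with free occ b in e
... | false with m≤n⇒m<n∨m≡n s≤b
...   | inj₂ refl = ¬free⇒∈ occ e
...   | inj₁ s<b = backward-nothing i b occ eq s<b (≤-pred (subst (suc b ≤_) (+-suc s i) a≤))

forward-just : ∀ n a occ {s} → forward n a occ ≡ just s → s List.∉ occ × s < n × a < s
forward-just n a occ eq with filterᵇ (λ s → (a <ᵇ s) ∧ free occ s) (upTo n) in e
forward-just n a occ refl | s ∷ _ with ∈-filter⁻ (T? ∘ λ s → (a <ᵇ s) ∧ free occ s) {xs = upTo n} (subst (s List.∈_) (sym e) (here refl))
... | s∈ , t with Equivalence.to T-∧ t
...   | a<s , fr = free⇒∉ occ (Equivalence.to T-≡ fr) , ∈-upTo⁻ s∈ , <ᵇ⇒< a s a<s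

forward-nothing : ∀ n a occ → forward n a occ ≡ nothing → ∀ {s} → a < s → s < n → s List.∈ occ
forward-nothing n a occ eq {s} a<s s<n with filterᵇ (λ s → (a <ᵇ s) ∧ free occ s) (upTo n) in e
... | [] with free occ s in fr
...   | false = ¬free⇒∈ occ fr
...   | true with subst (s List.∈_) e (∈-filter⁺ (T? ∘ λ s → (a <ᵇ s) ∧ free occ s) (∈-upTo⁺ s<n)
                    (Equivalence.from T-∧ (<⇒<ᵇ a<s , Equivalence.from T-≡ fr)))
...     | ()

-- This and `parkCar-nothing` are all that the argument keeps of the parking rule: a car never ends
-- more than `k` spots before `a`, and it fails only if every spot from `a ∸ k` on is taken.
parkCar-just : ∀ k n occ a {s} → parkCar k n occ a ≡ just s → a < n → s List.∉ occ × s < n × a ≤ s + k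
parkCar-just k n occ a eq a<n with free occ a in e
parkCar-just k n occ a refl a<n | true = free⇒∉ occ e , a<n , m≤m+n a k
... | false with backward k a occ in e′
parkCar-just k n occ a refl a<n | false | just s with backward-just k a occ e′
... | s∉ , s<a , a≤ = s∉ , <-trans s<a a<n , a≤
parkCar-just k n occ a {s} eq a<n | false | nothing with forward-just n a occ eq
... | s∉ , s<n , a<s = s∉ , s<n , ≤-trans (<⇒≤ a<s) (m≤m+n s k)

parkCar-nothing : ∀ k n occ a → parkCar k n occ a ≡ nothing → ∀ {s} → a ≤ s + k → s < n → s List.∈ occ
parkCar-nothing k n occ a eq {s} a≤ s<n with free occ a in e
... | false with backward k a occ in e′
...   | nothing with <-cmp s a
...     | tri< s<a _ _ = backward-nothing k a occ e′ s<a a≤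
...     | tri≈ _ refl _ = ¬free⇒∈ occ e
...     | tri> _ _ a<s = forward-nothing n a occ eq a<s s<n

-- Below c as: the entry x_j with 0-based index j satisfies x_j + j < c.
Below : ℕ → List ℕ → Set
Below c [] = ⊤
Below c (x ∷ xs) = x < c × Below (pred c) xs

Desc : ℕ → List ℕ → Set
Desc ℓ [] = ⊤
Desc ℓ (x ∷ xs) = x ≤ ℓ × Desc x xs

-- A failing car finds all spots from `a ∸ k` on taken, so at least `n ∸ (a ∸ k)` cars have parked.
-- That there are fewer follows from `a < c`, or for `a ≤ k` from the total number of cars.
-- Throughout, `c` is `n + k` minus the number of parked cars.
below⇒parkAll : ∀ k n occ as {c} → All (_< n) as → length occ + length as ≤ n →
  c + length occ ≡ n + k → Below c as → T (is-just (parkAll k n occ as))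
below⇒parkAll k n occ [] _ _ _ _ = tt
below⇒parkAll k n occ (a ∷ as) {suc c} (_ ∷ as<n) len ceq (a<c , b) with parkCar k n occ a in e
... | just s = below⇒parkAll k n (s ∷ occ) as as<n (subst (_≤ n) (+-suc _ _) len)
                 (trans (+-suc c _) ceq) b
... | nothing = contradiction full (notFull (≤-total k a))
  where
  full : n ≤ length occ + (a ∸ k)
  full = m∸n≤o⇒m≤o+n n (a ∸ k) (length occ) (subst (_≤ length occ) (length-applyUpTo _ (n ∸ (a ∸ k)))
    (unique-⊆⇒length≤ (interval-unique (a ∸ k) n)
      (λ p → let lo , hi = ∈-interval⁻ p in
        parkCar-nothing k n occ a e (≤-trans (m≤n+m∸n a k) (≤-trans (+-monoʳ-≤ k lo) (≤-reflexive (+-comm k _)))) hi)))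
    where
    m∸n≤o⇒m≤o+n : ∀ m n o → m ∸ n ≤ o → m ≤ o + n
    m∸n≤o⇒m≤o+n m n o p = ≤-trans (m≤n+m∸n m n) (≤-trans (+-monoʳ-≤ n p) (≤-reflexive (+-comm n o)))
  notFull : k ≤ a ⊎ a ≤ k → ¬ (n ≤ length occ + (a ∸ k))
  notFull (inj₂ a≤k) p = <⇒≱ (≤-trans (≤-trans (s≤s (m≤m+n (length occ) (length as))) (≤-reflexive (sym (+-suc _ _)))) len)
    (subst (n ≤_) (trans (cong (length occ +_) (m≤n⇒m∸n≡0 a≤k)) (+-identityʳ _)) p)
  notFull (inj₁ k≤a) p = <⇒≱ (+-monoˡ-< (length occ) a<c) (begin
    suc c + length occ          ≡⟨ ceq ⟩
    n + k                       ≤⟨ +-monoˡ-≤ k p ⟩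
    length occ + (a ∸ k) + k    ≡⟨ +-assoc (length occ) (a ∸ k) k ⟩
    length occ + (a ∸ k + k)    ≡⟨ cong (length occ +_) (m∸n+n≡m k≤a) ⟩
    length occ + a              ≡⟨ +-comm (length occ) a ⟩
    a + length occ              ∎)
    where open ≤-Reasoning

-- Every parked car stands at most `k` spots before the last preference `ℓ`, hence, by descent, at
-- most `k` before `a`. So the occupied spots and the new one are distinct members of the interval
-- from `a ∸ k` to `n`, whose length bounds their number.
parkAll⇒below : ∀ k n occ as {c ℓ} → Unique occ → All (_< n) occ → All (λ o → ℓ ≤ o + k) occ →
  All (_< n) as → Desc ℓ as → c + length occ ≡ n + k → T (is-just (parkAll k n occ as)) → Below c as
parkAll⇒below k n occ [] _ _ _ _ _ _ _ = tt
parkAll⇒below k n occ (a ∷ as) {c} {ℓ} u occ<n lowOcc (a<n ∷ as<n) (a≤ℓ , desc) ceq ok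
  with parkCar k n occ a in e
... | just s with parkCar-just k n occ a e a<n
...   | s∉ , s<n , a≤ = a<c ,
          parkAll⇒below k n (s ∷ occ) as u′ (s<n ∷ occ<n) (a≤ ∷ low) as<n desc ceq′ ok
  where
  u′ : Unique (s ∷ occ)
  u′ = All.tabulate (λ x∈ s≡x → s∉ (subst (List._∈ occ) (sym s≡x) x∈)) ∷ u
  low : All (λ o → a ≤ o + k) occ
  low = All.map (≤-trans a≤ℓ) lowOcc
  sub : ∀ {x} → x List.∈ s ∷ occ → x List.∈ interval (a ∸ k) n
  sub p = ∈-interval⁺ (m≤n+o⇒m∸n≤o a k (subst (a ≤_) (+-comm _ k) (All.lookup (a≤ ∷ low) p)))
                      (All.lookup (s<n ∷ occ<n) p)
  fits : suc (length occ) + (a ∸ k) ≤ n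
  fits = m≤o∸n⇒m+n≤o _ (≤-trans (m∸n≤m a k) (<⇒≤ a<n))
    (subst (suc (length occ) ≤_) (length-applyUpTo _ (n ∸ (a ∸ k))) (unique-⊆⇒length≤ u′ sub))
  a<c : a < c
  a<c = +-cancelʳ-< (length occ) a c (begin
    suc (a + length occ)                 ≤⟨ s≤s (+-monoˡ-≤ _ (m≤n+m∸n a k)) ⟩
    suc (k + (a ∸ k) + length occ)       ≡⟨ cong suc (+-assoc k _ _) ⟩
    suc (k + (a ∸ k + length occ))       ≡⟨ cong (λ z → suc (k + z)) (+-comm (a ∸ k) _) ⟩
    suc (k + (length occ + (a ∸ k)))     ≡⟨ +-suc k _ ⟨
    k + (suc (length occ) + (a ∸ k))     ≤⟨ +-monoʳ-≤ k fits ⟩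
    k + n                                ≡⟨ +-comm k n ⟩
    n + k                                ≡⟨ ceq ⟨
    c + length occ                       ∎)
    where open ≤-Reasoning
  ceq′ : pred c + suc (length occ) ≡ n + k
  ceq′ = trans (+-suc (pred c) _) (trans (cong (_+ length occ) (suc-pred c {{>-nonZero (≤-trans (s≤s z≤n) a<c)}})) ceq)

prefs : ∀ {n m} → Vec (Fin n) m → List ℕ
prefs a = map toℕ (toList a)

prefs< : ∀ {n m} (a : Vec (Fin n) m) → All (_< n) (prefs a)
prefs< [] = []
prefs< (x ∷ a) = Fin.toℕ<n x ∷ prefs< a

length-prefs : ∀ {n m} (a : Vec (Fin n) m) → length (prefs a) ≡ m
length-prefs a = trans (length-map toℕ (toList a)) (length-toList a)

prefs-injective : ∀ {n m} (a a′ : Vec (Fin n) m) → prefs a ≡ prefs a′ → a ≡ a′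
prefs-injective [] [] _ = refl
prefs-injective (x ∷ a) (y ∷ a′) eq = cong₂ _∷_
  (Fin.toℕ-injective (List.∷-injectiveˡ eq)) (prefs-injective a a′ (List.∷-injectiveʳ eq))

-- `Descending` ties the length to the range of the entries; separating the two lets inductions pass
-- to the tail.
DescVec : ∀ {n m} → Vec (Fin n) m → Set
DescVec {m = m} a = (i j : Fin m) → toℕ i ≤ toℕ j → toℕ (lookup a j) ≤ toℕ (lookup a i)

descVec⇒desc : ∀ {n m} ℓ (a : Vec (Fin n) m) → DescVec a → (∀ i → toℕ (lookup a i) ≤ ℓ) → Desc ℓ (prefs a)
descVec⇒desc ℓ [] d b = tt
descVec⇒desc ℓ (x ∷ a) d b = b zero ,
  descVec⇒desc (toℕ x) a (λ i j i≤j → d (suc i) (suc j) (s≤s i≤j)) (λ i → d zero (suc i) z≤n)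

desc⇒lookup≤ : ∀ {n m} ℓ (a : Vec (Fin n) m) → Desc ℓ (prefs a) → ∀ i → toℕ (lookup a i) ≤ ℓ
desc⇒lookup≤ ℓ (x ∷ a) (x≤ℓ , d) zero = x≤ℓ
desc⇒lookup≤ ℓ (x ∷ a) (x≤ℓ , d) (suc i) = ≤-trans (desc⇒lookup≤ (toℕ x) a d i) x≤ℓ

desc⇒descVec : ∀ {n m} ℓ (a : Vec (Fin n) m) → Desc ℓ (prefs a) → DescVec a
desc⇒descVec ℓ (x ∷ a) (_ , d) zero zero _ = ≤-refl
desc⇒descVec ℓ (x ∷ a) (_ , d) zero (suc j) _ = desc⇒lookup≤ (toℕ x) a d j
desc⇒descVec ℓ (x ∷ a) (_ , d) (suc i) (suc j) (s≤s i≤j) = desc⇒descVec (toℕ x) a d i j i≤j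

fromPrefs : ∀ {n} as ℓ m → Desc ℓ as → ℓ < n → length as ≡ m → Σ (Vec (Fin n) m) λ a → prefs a ≡ as
fromPrefs [] ℓ zero d ℓ<n eq = [] , refl
fromPrefs (x ∷ as) ℓ (suc m) (x≤ℓ , d) ℓ<n eq with fromPrefs as x m d (≤-<-trans x≤ℓ ℓ<n) (suc-injective eq)
... | a , refl = fromℕ< x<n ∷ a , cong (_∷ prefs a) (Fin.toℕ-fromℕ< x<n)
  where x<n = ≤-<-trans x≤ℓ ℓ<n

below⇒naples : ∀ k n (a : Vec (Fin n) n) → Below (n + k) (prefs a) → IsNaples k n a
below⇒naples k n a = below⇒parkAll k n [] (prefs a) (prefs< a) (≤-reflexive (length-prefs a)) (+-identityʳ _)

naples⇒below : ∀ k n (a : Vec (Fin n) n) {ℓ} → Desc ℓ (prefs a) → IsNaples k n a → Below (n + k) (prefs a)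
naples⇒below k n a d = parkAll⇒below k n [] (prefs a) [] [] [] (prefs< a) d (+-identityʳ _)

-- Descending preferences as sequences of trees

data Tree : Set where
  leaf : Tree
  node : Tree → Tree → Tree

nodes : Tree → ℕ
nodes leaf = 0
nodes (node l r) = suc (nodes l + nodes r)

leaves : Tree → ℕ
leaves leaf = 1
leaves (node l r) = leaves l + leaves r

allNodes : List Tree → ℕ
allNodes ts = sum (map nodes ts)

-- Parse ℓ as p q t ts: the word of the descending list as, with its letters N counted down from ℓ, factors as
-- t followed by ts, the first p separators being unmatched E and the remaining q unmatched N.
data Parse : ℕ → List ℕ → ℕ → ℕ → Tree → List Tree → Set where
  nil : Parse 0 [] 0 0 leaf []
  east : ∀ {ℓ as p q t ts} → Parse ℓ as p q t ts → Parse ℓ (ℓ ∷ as) (suc p) q leaf (t ∷ ts)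
  merge : ∀ {ℓ as p q l r ts} → Parse ℓ as (suc p) q l (r ∷ ts) → Parse (suc ℓ) as p q (node l r) ts
  north : ∀ {ℓ as q t ts} → Parse ℓ as 0 q t ts → Parse (suc ℓ) as 0 (suc q) leaf (t ∷ ts)

parse-length : ∀ {ℓ as p q t ts} → Parse ℓ as p q t ts → length ts ≡ p + q
parse-length nil = refl
parse-length (east P) = cong suc (parse-length P)
parse-length (merge P) = suc-injective (parse-length P)
parse-length (north P) = cong suc (parse-length P)

-- The letters E are the `p` unmatched ones and one per node; `parse-norths` counts the letters N
-- likewise. A list of length `suc ℓ` therefore has `p ≡ suc q`.
parse-easts : ∀ {ℓ as p q t ts} → Parse ℓ as p q t ts → length as ≡ p + (nodes t + allNodes ts)
parse-easts nil = refl
parse-easts (east P) = cong suc (parse-easts P)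
parse-easts (merge {p = p} {l = l} {r} {ts} P) = trans (parse-easts P) (trans (sym (+-suc p _))
  (cong (λ z → p + suc z) (sym (+-assoc (nodes l) (nodes r) (allNodes ts)))))
parse-easts (north P) = parse-easts P

parse-norths : ∀ {ℓ as p q t ts} → Parse ℓ as p q t ts → ℓ ≡ q + (nodes t + allNodes ts)
parse-norths nil = refl
parse-norths (east P) = parse-norths P
parse-norths (merge {q = q} {l = l} {r} {ts} P) = trans (cong suc (parse-norths P)) (trans (sym (+-suc q _))
  (cong (λ z → q + suc z) (sym (+-assoc (nodes l) (nodes r) (allNodes ts)))))
parse-norths (north P) = cong suc (parse-norths P)

desc-weaken : ∀ {ℓ ℓ′ as} → ℓ ≤ ℓ′ → Desc ℓ as → Desc ℓ′ as
desc-weaken {as = []} _ d = d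
desc-weaken {as = x ∷ as} ℓ≤ (x≤ , d) = ≤-trans x≤ ℓ≤ , d

parse-desc : ∀ {ℓ as p q t ts} → Parse ℓ as p q t ts → Desc ℓ as
parse-desc nil = tt
parse-desc (east P) = ≤-refl , parse-desc P
parse-desc (merge P) = desc-weaken (n≤1+n _) (parse-desc P)
parse-desc (north P) = desc-weaken (n≤1+n _) (parse-desc P)

Parsed : ℕ → List ℕ → Set
Parsed ℓ as = ∃ λ p → ∃ λ q → ∃ λ t → ∃ λ ts → Parse ℓ as p q t ts

-- A prefixed N takes the first unmatched E as its partner, if there is one, and otherwise stays
-- unmatched. A prefixed E never finds a partner, since partners of an E stand before it.
parse-step : ∀ {ℓ as} → Parsed ℓ as → Parsed (suc ℓ) as
parse-step (zero , q , t , ts , P) = _ , _ , _ , _ , north P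
parse-step (suc p , q , t , r ∷ ts , P) = _ , _ , _ , _ , merge P
parse-step (suc p , q , t , [] , P) with parse-length P
... | ()

-- The word is built from its right end. In front of the E of an entry `x` stand `ℓ − x` letters N,
-- one for each step of `x ≤′ ℓ`.
parse : ∀ ℓ as → Desc ℓ as → Parsed ℓ as
parse-head : ∀ ℓ x as → x ≤′ ℓ → Desc x as → Parsed ℓ (x ∷ as)
parse zero [] d = _ , _ , _ , _ , nil
parse (suc ℓ) [] d = parse-step (parse ℓ [] d)
parse ℓ (x ∷ as) (x≤ℓ , d) = parse-head ℓ x as (≤⇒≤′ x≤ℓ) d
parse-head ℓ .ℓ as (≤′-reflexive refl) d with parse ℓ as d
... | p , q , t , ts , P = _ , _ , _ , _ , east P
parse-head .(suc _) x as (≤′-step le) d = parse-step (parse-head _ x as le d)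

-- A leaf is the empty word and `node l r` is N l E r. Prefixing this word from its right end means
-- writing `r`, then E, then `l`, then N.
unparse-tree : ∀ {ℓ as p q ts} t → Parse ℓ as p q leaf ts → ∃ λ ℓ′ → ∃ λ as′ → Parse ℓ′ as′ p q t ts
unparse-tree leaf P = _ , _ , P
unparse-tree (node l r) P with unparse-tree r P
... | _ , _ , P₁ with unparse-tree l (east P₁)
...   | _ , _ , P₂ = _ , _ , merge P₂

unparse : ∀ p q t ts → length ts ≡ p + q → ∃ λ ℓ → ∃ λ as → Parse ℓ as p q t ts
unparse zero zero t [] eq = unparse-tree t nil
unparse (suc p) q t (t′ ∷ ts) eq with unparse p q t′ ts (suc-injective eq)
... | _ , _ , P = unparse-tree t (east P)
unparse zero (suc q) t (t′ ∷ ts) eq with unparse zero q t′ ts (suc-injective eq)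
... | _ , _ , P = unparse-tree t (north P)

parse-injective : ∀ {ℓ ℓ′ as as′ p q t ts} → Parse ℓ as p q t ts → Parse ℓ′ as′ p q t ts → ℓ ≡ ℓ′ × as ≡ as′
parse-injective nil nil = refl , refl
parse-injective (east P) (east Q) with parse-injective P Q
... | refl , refl = refl , refl
parse-injective (merge P) (merge Q) with parse-injective P Q
... | refl , refl = refl , refl
parse-injective (north P) (north Q) with parse-injective P Q
... | refl , refl = refl , refl

parse-functional : ∀ {ℓ as p q t ts p′ q′ t′ ts′} → Parse ℓ as p q t ts → Parse ℓ as p′ q′ t′ ts′ →
  p ≡ p′ × q ≡ q′ × t ≡ t′ × ts ≡ ts′
parse-functional nil nil = refl , refl , refl , refl
parse-functional (east P) (east Q) with parse-functional P Q
... | refl , refl , refl , refl = refl , refl , refl , refl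
-- After an initial N all entries are at most the lowered level, so the list cannot begin with the
-- entry that an initial E would give.
parse-functional (east P) (merge Q) = contradiction (proj₁ (parse-desc Q)) 1+n≰n
parse-functional (east P) (north Q) = contradiction (proj₁ (parse-desc Q)) 1+n≰n
parse-functional (merge P) (east Q) = contradiction (proj₁ (parse-desc P)) 1+n≰n
parse-functional (north P) (east Q) = contradiction (proj₁ (parse-desc P)) 1+n≰n
parse-functional (merge P) (merge Q) with parse-functional P Q
... | refl , refl , refl , refl = refl , refl , refl , refl
parse-functional (merge P) (north Q) with parse-functional P Q
... | () , _
parse-functional (north P) (merge Q) with parse-functional P Q
... | () , _
parse-functional (north P) (north Q) with parse-functional P Q
... | refl , refl , refl , refl = refl , refl , refl , refl

-- `K` is the excess of letters E still permitted: an E uses one up, an N gives one back. So `K + ℓ`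
-- keeps pace with the bound in `Below`, which drops by one per entry and does not see the letters
-- N.
below⇒≤ : ∀ {ℓ as p q t ts} K → Parse ℓ as p q t ts → Below (K + ℓ) as → p ≤ K
below⇒≤ K nil _ = z≤n
below⇒≤ zero (east P) (ℓ<ℓ , _) = contradiction ℓ<ℓ 1+n≰n
below⇒≤ (suc K) (east P) (_ , b) = s≤s (below⇒≤ K P b)
below⇒≤ {as = as} K (merge {ℓ} P) b = ≤-pred (below⇒≤ (suc K) P (subst (λ c → Below c as) (+-suc K ℓ) b))
below⇒≤ K (north P) b = z≤n

≤⇒below : ∀ {ℓ as p q t ts} K → Parse ℓ as p q t ts → p ≤ K → Below (K + ℓ) as
≤⇒below K nil _ = tt
≤⇒below (suc K) (east P) (s≤s p≤K) = s≤s (m≤n+m _ K) , ≤⇒below K P p≤K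
≤⇒below {as = as} K (merge {ℓ} P) p≤K = subst (λ c → Below c as) (sym (+-suc K ℓ)) (≤⇒below (suc K) P (s≤s p≤K))
≤⇒below {as = as} K (north {ℓ} P) p≤K = subst (λ c → Below c as) (sym (+-suc K ℓ)) (≤⇒below (suc K) P z≤n)

-- Trees cut along their spines, and blueprints of marked dissections

leaves≡suc-nodes : ∀ t → leaves t ≡ suc (nodes t)
leaves≡suc-nodes leaf = refl
leaves≡suc-nodes (node l r) rewrite leaves≡suc-nodes l | leaves≡suc-nodes r = cong suc (+-suc (nodes l) (nodes r))

-- A left spine above `t`, listed from the root: the head of `ws` hangs highest. Its nodes become
-- chords at vertex 0.
comb : Tree → List Tree → Tree
comb t [] = t
comb t (w ∷ ws) = node (comb t ws) w

rightSpine : Tree → List Tree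
rightSpine leaf = []
rightSpine (node l r) = l ∷ rightSpine r

fromRightSpine : List Tree → Tree
fromRightSpine [] = leaf
fromRightSpine (t ∷ ts) = node t (fromRightSpine ts)

rightSpine-from : ∀ ts → rightSpine (fromRightSpine ts) ≡ ts
rightSpine-from [] = refl
rightSpine-from (t ∷ ts) = cong (t ∷_) (rightSpine-from ts)

rightSpine-injective : ∀ t t′ → rightSpine t ≡ rightSpine t′ → t ≡ t′
rightSpine-injective leaf leaf _ = refl
rightSpine-injective (node l r) (node l′ r′) eq with List.∷-injective eq
... | refl , eq′ = cong (node l) (rightSpine-injective r r′ eq′)

allLeaves : List Tree → ℕ
allLeaves ts = sum (map leaves ts)

-- Each node of the right spine pays for the one leaf by which its left subtree exceeds its own
-- number of nodes.
allLeaves-rightSpine : ∀ t → allLeaves (rightSpine t) ≡ nodes t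
allLeaves-rightSpine leaf = refl
allLeaves-rightSpine (node l r) = cong₂ _+_ (leaves≡suc-nodes l) (allLeaves-rightSpine r)

allLeaves≡ : ∀ ts → allLeaves ts ≡ length ts + allNodes ts
allLeaves≡ [] = refl
allLeaves≡ (t ∷ ts) rewrite leaves≡suc-nodes t | allLeaves≡ ts = cong suc
  (solve 3 (λ a b c → a :+ (b :+ c) := b :+ (a :+ c)) refl (nodes t) (length ts) (allNodes ts))
  where open +-*-Solver

leaves-comb : ∀ t ws → leaves (comb t ws) ≡ leaves t + allLeaves ws
leaves-comb t [] = sym (+-identityʳ _)
leaves-comb t (w ∷ ws) rewrite leaves-comb t ws =
  solve 3 (λ a b c → a :+ b :+ c := a :+ (c :+ b)) refl (leaves t) (allLeaves ws) (leaves w)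
  where open +-*-Solver

-- `base` lies under the side from 0 to the next corner of the (2k+2)-gon, `inner` under its `2 * k`
-- sides that avoid 0, and `outer` beyond the marked side. The `N` leaves are all sides of the large
-- polygon except the closing one, so that polygon has `N + 1` sides.
record Blueprint (k N : ℕ) : Set where
  constructor blueprint
  field
    base : Tree
    inner outer : List Tree
    length-inner : length inner ≡ 2 * k
    leaves-whole : leaves (comb (comb base inner) outer) ≡ N

  polygonTree : Tree
  polygonTree = comb base inner

  wholeTree : Tree
  wholeTree = comb polygonTree outer
open Blueprint public

-- Only the trees are compared, so the proof fields never have to be identified.
SameTrees : ∀ {k N} → Blueprint k N → Blueprint k N → Set
SameTrees B B′ = base B ≡ base B′ × inner B ≡ inner B′ × outer B ≡ outer B′

width≡ : ∀ h t ts → leaves (comb (comb t ts) (rightSpine h)) ≡ suc (length ts) + (nodes h + (nodes t + allNodes ts))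
width≡ h t ts rewrite leaves-comb (comb t ts) (rightSpine h) | leaves-comb t ts | allLeaves-rightSpine h
  | leaves≡suc-nodes t | allLeaves≡ ts = cong suc
  (solve 4 (λ a b c d → a :+ (b :+ c) :+ d := b :+ (d :+ (a :+ c))) refl (nodes t) (length ts) (allNodes ts) (nodes h))
  where open +-*-Solver

module _ (k n : ℕ) where

  n+k≡ : ∀ j → suc n + j ≡ suc j + n
  n+k≡ j = cong suc (+-comm n j)

  abstract
    -- The Naples condition bounds `p` from above, its failure for one less bounds `p` from below.
    -- Then `q` is forced by the surplus of a single E: `suc n` cars against a descent by `n`.
    strict⇒parse : (x : DescStrictNaples (suc k) (suc n)) →
      ∃ λ h → ∃ λ ts → Parse n (prefs (proj₁ x)) (suc (suc k)) (suc k) h ts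
    strict⇒parse (a , d , nap , ¬nap)
      with descVec⇒desc n a d (λ i → ≤-pred (Fin.toℕ<n (lookup a i)))
    ... | desc with parse n (prefs a) desc
    ...   | p , q , h , ts , P = h , ts , subst₂ (λ p q → Parse n (prefs a) p q h ts) p≡ q≡ P
      where
      p≤ : p ≤ suc (suc k)
      p≤ = below⇒≤ (suc (suc k)) P
        (subst (λ c → Below c (prefs a)) (n+k≡ (suc k)) (naples⇒below (suc k) (suc n) a desc nap))
      p≰ : ¬ (p ≤ suc k)
      p≰ p≤k = ¬nap (below⇒naples k (suc n) a
        (subst (λ c → Below c (prefs a)) (sym (n+k≡ k)) (≤⇒below (suc k) P p≤k)))
      p≡ : p ≡ suc (suc k)
      p≡ = ≤-antisym p≤ (≰⇒> p≰)
      M : ℕ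
      M = nodes h + allNodes ts
      q≡ : q ≡ suc k
      q≡ = +-cancelʳ-≡ M q (suc k) (suc-injective (begin
        suc (q + M)           ≡⟨ cong suc (parse-norths P) ⟨
        suc n                 ≡⟨ length-prefs a ⟨
        length (prefs a)      ≡⟨ parse-easts P ⟩
        p + M                 ≡⟨ cong (_+ M) p≡ ⟩
        suc (suc k + M)       ∎))
        where open ≡-Reasoning

  -- The first tree goes beyond the marked side, the second becomes the base. The parse is a
  -- separate argument so that it can be compared with any other parse of the same list.
  toBlueprint : ∀ as → ∃ (λ h → ∃ λ ts → Parse n as (suc (suc k)) (suc k) h ts) → length as ≡ suc n →
    Blueprint (suc k) (suc n + suc k)
  toBlueprint as (h , [] , P) len with parse-length P
  ... | ()
  toBlueprint as (h , t ∷ ts , P) len = blueprint t ts (rightSpine h) lenTs (begin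
      leaves (comb (comb t ts) (rightSpine h))   ≡⟨ width≡ h t ts ⟩
      suc (length ts) + M                        ≡⟨ cong (λ z → suc z + M) lenTs ⟩
      suc (2 * suc k) + M                        ≡⟨ solve 2 (λ k m → con 1 :+ con 2 :* (con 1 :+ k) :+ m
                                                      := con 2 :+ k :+ m :+ (con 1 :+ k)) refl k M ⟩
      suc (suc k) + M + suc k                    ≡⟨ cong (_+ suc k) (parse-easts P) ⟨
      length as + suc k                          ≡⟨ cong (_+ suc k) len ⟩
      suc n + suc k                              ∎)
    where
    open +-*-Solver
    open ≡-Reasoning
    M = nodes h + (nodes t + allNodes ts)
    lenTs : length ts ≡ 2 * suc k
    lenTs = trans (suc-injective (parse-length P)) (cong (λ z → suc (k + suc z)) (sym (+-identityʳ k)))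

  strictBlueprint : DescStrictNaples (suc k) (suc n) → Blueprint (suc k) (suc n + suc k)
  strictBlueprint x = toBlueprint (prefs (proj₁ x)) (strict⇒parse x) (length-prefs (proj₁ x))

  toBlueprint-injective : ∀ {as as′} P P′ {len : length as ≡ suc n} {len′ : length as′ ≡ suc n} →
    SameTrees (toBlueprint as P len) (toBlueprint as′ P′ len′) → as ≡ as′
  toBlueprint-injective (_ , [] , P) _ same with parse-length P
  ... | ()
  toBlueprint-injective (_ , _ ∷ _ , _) (_ , [] , P) same with parse-length P
  ... | ()
  toBlueprint-injective (h , t ∷ ts , P) (h′ , .t ∷ .ts , P′) (refl , refl , eq)
    with rightSpine-injective h h′ eq
  ... | refl = proj₂ (parse-injective P P′)

  strictBlueprint-injective : ∀ x y → SameTrees (strictBlueprint x) (strictBlueprint y) → proj₁ x ≡ proj₁ y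
  strictBlueprint-injective x y same = prefs-injective (proj₁ x) (proj₁ y)
    (toBlueprint-injective (strict⇒parse x) (strict⇒parse y)
      {length-prefs (proj₁ x)} {length-prefs (proj₁ y)} same)

  toBlueprint-parse : ∀ {as h t ts} P {len : length as ≡ suc n} →
    Parse n as (suc (suc k)) (suc k) h (t ∷ ts) →
    base (toBlueprint as P len) ≡ t × inner (toBlueprint as P len) ≡ ts × outer (toBlueprint as P len) ≡ rightSpine h
  toBlueprint-parse (_ , [] , P) _ with parse-length P
  ... | ()
  toBlueprint-parse (_ , _ ∷ _ , P) Q with parse-functional P Q
  ... | refl , refl , refl , refl = refl , refl , refl

  strictBlueprint-surjective : ∀ B → ∃ λ x → SameTrees (strictBlueprint x) B
  strictBlueprint-surjective B
    with h ← fromRightSpine (outer B) in eqh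
    with unparse (suc (suc k)) (suc k) h (base B ∷ inner B)
           (cong suc (trans (length-inner B) (cong (λ z → suc (k + suc z)) (+-identityʳ k))))
  -- Unparsing returns some level `ℓ`; counting the leaves of the blueprint shows that it is `n`.
  ... | ℓ , as , P with +-cancelʳ-≡ (suc k) (suc ℓ) (suc n) (begin
        suc ℓ + suc k           ≡⟨ cong (λ z → suc z + suc k) (parse-norths P) ⟩
        suc (suc k + M) + suc k ≡⟨ solve 2 (λ k m → con 1 :+ (con 1 :+ k :+ m) :+ (con 1 :+ k)
                                       := con 1 :+ con 2 :* (con 1 :+ k) :+ m) refl k M ⟩
        suc (2 * suc k) + M     ≡⟨ cong (λ z → suc z + M) (length-inner B) ⟨
        suc (length (inner B)) + M ≡⟨ width≡ h (base B) (inner B) ⟨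
        leaves (comb (comb (base B) (inner B)) (rightSpine h)) ≡⟨ cong (λ us → leaves (comb (polygonTree B) us)) spine≡ ⟩
        leaves (wholeTree B)    ≡⟨ leaves-whole B ⟩
        suc n + suc k           ∎)
    where
    open +-*-Solver
    open ≡-Reasoning
    M = nodes h + (nodes (base B) + allNodes (inner B))
    spine≡ : rightSpine h ≡ outer B
    spine≡ = trans (cong rightSpine (sym eqh)) (rightSpine-from (outer B))
  ...   | refl with fromPrefs as n (suc n) (parse-desc P) ≤-refl
                     (trans (parse-easts P) (cong suc (sym (parse-norths P))))
  ...     | a , refl = x , proj₁ same , proj₁ (proj₂ same) ,
              trans (proj₂ (proj₂ same)) (trans (cong rightSpine (sym eqh)) (rightSpine-from (outer B)))
    where
    x : DescStrictNaples (suc k) (suc n)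
    x = a , desc⇒descVec n a (parse-desc P) ,
      below⇒naples (suc k) (suc n) a (subst (λ c → Below c as) (sym (n+k≡ (suc k))) (≤⇒below (suc (suc k)) P ≤-refl)) ,
      λ nap → 1+n≰n (below⇒≤ (suc k) P
        (subst (λ c → Below c as) (n+k≡ k) (naples⇒below k (suc n) a (parse-desc P) nap)))
    same = toBlueprint-parse (strict⇒parse x) {length-prefs a} P

-- Faces of a dissection

infix 4 _≺_ _≼_
_≺_ _≼_ : ∀ {m} → Fin m → Fin m → Set
i ≺ j = toℕ i < toℕ j
i ≼ j = toℕ i ≤ toℕ j

≼∧≢⇒≺ : ∀ {m} {i j : Fin m} → i ≼ j → i ≢ j → i ≺ j
≼∧≢⇒≺ le ne = ≤∧≢⇒< le (ne ∘ Fin.toℕ-injective)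

≼∧∉∈⇒≺ : ∀ {m} {S : Subset m} {i j} → i ≼ j → i ∈ S → j ∉ S → i ≺ j
≼∧∉∈⇒≺ le p q = ≼∧≢⇒≺ le λ { refl → q p }

≼∧∈∉⇒≺ : ∀ {m} {S : Subset m} {i j} → i ≼ j → i ∉ S → j ∈ S → i ≺ j
≼∧∈∉⇒≺ le p q = ≼∧≢⇒≺ le λ { refl → p q }

≺-irrefl : ∀ {m} {i j : Fin m} → i ≺ j → i ≢ j
≺-irrefl i<i refl = <-irrefl refl i<i

module _ {m : ℕ} {P : Fin m → Set} (P? : ∀ x → Dec (P x)) where

  abstract
    greatest : ∀ {y} → P y → ∃ λ z → P z × y ≼ z × (∀ w → P w → w ≼ z)
    greatest {y} py = go m (m≤n+m m (toℕ y)) py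
      where
      go : ∀ f {y} → m ≤ toℕ y + f → P y → ∃ λ z → P z × y ≼ z × (∀ w → P w → w ≼ z)
      go zero {y} le py = contradiction (subst (m ≤_) (+-identityʳ _) le) (<⇒≱ (Fin.toℕ<n y))
      go (suc f) {y} le py with any? (λ w → P? w ×-dec (toℕ y <? toℕ w))
      ... | no ¬w = y , py , ≤-refl , λ w pw → ≮⇒≥ (λ y<w → ¬w (w , pw , y<w))
      ... | yes (w , pw , y<w) with go f (≤-trans le (≤-trans (≤-reflexive (+-suc _ f)) (+-monoˡ-≤ f y<w))) pw
      ...   | z , pz , w≤z , top = z , pz , ≤-trans (<⇒≤ y<w) w≤z , top

  abstract
    least : ∀ {y} → P y → ∃ λ z → P z × z ≼ y × (∀ w → P w → z ≼ w)
    least {y} py = go (toℕ y) ≤-refl py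
      where
      go : ∀ f {y} → toℕ y ≤ f → P y → ∃ λ z → P z × z ≼ y × (∀ w → P w → z ≼ w)
      go f {y} le py with any? (λ w → P? w ×-dec (toℕ w <? toℕ y))
      ... | no ¬w = y , py , ≤-refl , λ w pw → ≮⇒≥ (λ w<y → ¬w (w , pw , w<y))
      go zero le py | yes (w , pw , w<y) = contradiction (<-≤-trans w<y le) n≮0
      go (suc f) le py | yes (w , pw , w<y) with go f (≤-pred (<-≤-trans w<y le)) pw
      ... | z , pz , z≤w , bot = z , pz , ≤-trans z≤w (<⇒≤ w<y) , bot

  subset : Subset m
  subset = tabulate (does ∘ P?)

  ∈-subset⁺ : ∀ {x} → P x → x ∈ subset
  ∈-subset⁺ {x} px = lookup⇒[]= x subset (trans (lookup∘tabulate (does ∘ P?) x) (dec-true (P? x) px))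

  ∈-subset⁻ : ∀ {x} → x ∈ subset → P x
  ∈-subset⁻ {x} x∈ with P? x | trans (sym (lookup∘tabulate (does ∘ P?) x)) ([]=⇒lookup x∈)
  ... | yes px | _ = px
  ... | no _ | ()

module _ {m : ℕ} where

  -- For a face, `a` and `b` are the ends of the side that closes it and under which it lies. By
  -- `face-unique` this side determines the face.
  Span : Subset m → Fin m → Fin m → Set
  Span S a b = a ∈ S × b ∈ S × (∀ c → c ∈ S → a ≼ c × c ≼ b)

  abstract
    neighbours : ∀ {S : Subset m} {x y z} → x ∉ S → y ∈ S → y ≺ x → z ∈ S → x ≺ z →
      ∃ λ y′ → ∃ λ z′ → y′ ∈ S × z′ ∈ S × y ≼ y′ × y′ ≺ x × x ≺ z′ × z′ ≼ z ×
        (∀ c → c ∈ S → ¬ (y′ ≺ c × c ≺ z′))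
    neighbours {S} {x} x∉ y∈ y<x z∈ x<z
      with greatest (λ w → (w ∈? S) ×-dec (toℕ w <? toℕ x)) (y∈ , y<x)
         | least (λ w → (w ∈? S) ×-dec (toℕ x <? toℕ w)) (z∈ , x<z)
    ... | y′ , (y′∈ , y′<x) , y≤y′ , top | z′ , (z′∈ , x<z′) , z′≤z , bot =
      y′ , z′ , y′∈ , z′∈ , y≤y′ , y′<x , x<z′ , z′≤z , gap
      where
      gap : ∀ c → c ∈ S → ¬ (y′ ≺ c × c ≺ z′)
      gap c c∈ (y′<c , c<z′) with <-cmp (toℕ c) (toℕ x)
      ... | tri< c<x _ _ = <⇒≱ y′<c (top c (c∈ , c<x))
      ... | tri≈ _ c≡x _ = x∉ (subst (_∈ S) (Fin.toℕ-injective c≡x) c∈)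
      ... | tri> _ _ x<c = <⇒≱ c<z′ (bot c (c∈ , x<c))

  abstract
    span : ∀ {S : Subset m} {x} → x ∈ S → ∃ λ a → ∃ λ b → Span S a b
    span {S} x∈ with least (_∈? S) x∈ | greatest (_∈? S) x∈
    ... | a , a∈ , _ , bot | b , b∈ , _ , top = a , b , a∈ , b∈ , λ c c∈ → bot c c∈ , top c c∈

  abstract
    inhabited : ∀ {S : Subset m} {r} → suc r ≤ ∣ S ∣ → ∃ (_∈ S)
    inhabited {S} r<S with any? (_∈? S)
    ... | yes x = x
    ... | no ¬x = contradiction (≤-trans r<S (covered⇒∣∣≤length {xs = []} (λ x∈ → contradiction (_ , x∈) ¬x))) λ ()

  abstract
    between : ∀ {S : Subset m} {a b} → 3 ≤ ∣ S ∣ → Span S a b → ∃ λ x → x ∈ S × a ≺ x × x ≺ b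
    between {S} {a} {b} 3≤ (a∈ , b∈ , bd) with any? (λ x → (x ∈? S) ×-dec (toℕ a <? toℕ x) ×-dec (toℕ x <? toℕ b))
    ... | yes e = e
    ... | no ¬e = contradiction (≤-trans 3≤ (covered⇒∣∣≤length {xs = a ∷ b ∷ []} cover)) λ { (s≤s (s≤s ())) }
      where
      cover : ∀ {x} → x ∈ S → x List.∈ a ∷ b ∷ []
      cover {x} x∈ with x Fin.≟ a | x Fin.≟ b
      ... | yes refl | _ = here refl
      ... | no _ | yes refl = there (here refl)
      ... | no x≢a | no x≢b = contradiction
        (x , x∈ , ≼∧≢⇒≺ (proj₁ (bd x x∈)) (x≢a ∘ sym) , ≼∧≢⇒≺ (proj₂ (bd x x∈)) x≢b) ¬e

  side? : ∀ (i j : Fin m) → Dec (Side i j)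
  side? i j = (toℕ j ≟ suc (toℕ i)) ⊎-dec (toℕ i ≟ suc (toℕ j))
    ⊎-dec ((toℕ i ≟ 0) ×-dec (suc (toℕ j) ≟ m)) ⊎-dec ((toℕ j ≟ 0) ×-dec (suc (toℕ i) ≟ m))

  side-≺ : ∀ {i j : Fin m} → Side i j → i ≺ j → toℕ j ≡ suc (toℕ i) ⊎ (toℕ i ≡ 0 × suc (toℕ j) ≡ m)
  side-≺ (inj₁ eq) _ = inj₁ eq
  side-≺ (inj₂ (inj₁ eq)) i<j = contradiction (≤-trans (n≤1+n _) (≤-reflexive (sym eq))) (<⇒≱ i<j)
  side-≺ (inj₂ (inj₂ (inj₁ e))) _ = inj₂ e
  side-≺ (inj₂ (inj₂ (inj₂ (eq , _)))) i<j = contradiction (subst (_ <_) eq i<j) n≮0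

  module _ (Δ : Dissection m) where

    edge? : ∀ i j → Dec (Edge Δ i j)
    edge? i j = side? i j ⊎-dec T? (D Δ i j)

    -- Non-crossing is given for diagonals only. This lets it be applied to an edge with a vertex
    -- under it, once the side joining the first and the last vertex is excluded.
    edge⇒D : ∀ {i j x} → Edge Δ i j → i ≺ x → x ≺ j → ¬ (toℕ i ≡ 0 × suc (toℕ j) ≡ m) → T (D Δ i j)
    edge⇒D (inj₂ d) _ _ _ = d
    edge⇒D (inj₁ s) i<x x<j ¬r with side-≺ s (<-trans i<x x<j)
    ... | inj₁ eq = contradiction i<x (≤⇒≯ (≤-pred (subst (_ <_) eq x<j)))
    ... | inj₂ r = contradiction r ¬r

    abstract
      -- If `y` or `z` were not in `P`, it would lie under a side of `P`, and that side would cross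
      -- the chord. So both are in `P` and hence consecutive there; as `x` lies between them, they
      -- are the closing pair.
      chord-around : ∀ {P a b x y z} → Face Δ P → Span P a b → a ≼ y → z ≼ b → x ∈ P → y ≺ x → x ≺ z →
        T (D Δ y z) → y ≼ a × b ≼ z
      chord-around {P} {a} {b} {x} {y} {z} (_ , edgesP , uncutP) (a∈P , b∈P , _) a≤y z≤b x∈P y<x x<z Dyz = ends
        where
        y∈P : y ∈ P
        y∈P with y ∈? P
        ... | yes p = p
        ... | no y∉P with neighbours y∉P a∈P (≼∧∉∈⇒≺ a≤y a∈P y∉P) x∈P y<x
        ...   | u , v , u∈ , v∈ , _ , u<y , y<v , v≤x , gap = contradiction (u<y , y<v , ≤-<-trans v≤x x<z)
                (D-noncr Δ u v y z Duv Dyz)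
          where
          Duv : T (D Δ u v)
          Duv = edge⇒D (edgesP u v (u∈ , v∈ , <-trans u<y y<v , inj₁ gap)) u<y y<v
            λ (_ , v≡m) → <⇒≱ (Fin.toℕ<n z) (subst (_≤ toℕ z) v≡m (≤-<-trans v≤x x<z))
        z∈P : z ∈ P
        z∈P with z ∈? P
        ... | yes p = p
        ... | no z∉P with neighbours z∉P x∈P x<z b∈P (≼∧∈∉⇒≺ z≤b z∉P b∈P)
        ...   | u , v , u∈ , v∈ , x≤u , u<z , z<v , _ , gap = contradiction (<-≤-trans y<x x≤u , u<z , z<v)
                (D-noncr Δ y z u v Dyz Duv)
          where
          Duv : T (D Δ u v)
          Duv = edge⇒D (edgesP u v (u∈ , v∈ , <-trans u<z z<v , inj₁ gap)) u<z z<v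
            λ (u≡0 , _) → n≮0 (subst (toℕ y <_) u≡0 (<-≤-trans y<x x≤u))
        ends : y ≼ a × b ≼ z
        ends with uncutP y z y∈P z∈P (<-trans y<x x<z) Dyz
        ... | _ , _ , _ , inj₁ none = contradiction (y<x , x<z) (none x x∈P)
        ... | _ , _ , _ , inj₂ all = proj₁ (all a a∈P) , proj₂ (all b b∈P)

    -- A vertex of `P` outside `S` lies under a side `yz` of `S`. By `chord-around` that side spans
    -- all from `a` to `b`, which leaves no place for a third vertex of `S`.
    face-⊆ : ∀ {S P a b} → Face Δ S → Face Δ P → Span S a b → Span P a b → P ⊆ S
    face-⊆ {S} {P} {a} {b} (3≤ , edges , _) P-face sp@(a∈ , b∈ , bd) spP@(_ , _ , bdP) {x} x∈P
      with x ∈? S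
    ... | yes x∈ = x∈
    ... | no x∉ with neighbours x∉ a∈ (≼∧∉∈⇒≺ (proj₁ (bdP x x∈P)) a∈ x∉) b∈ (≼∧∈∉⇒≺ (proj₂ (bdP x x∈P)) x∉ b∈)
                   | between 3≤ sp
    ...   | y , z , y∈ , z∈ , a≤y , y<x , x<z , z≤b , gap | e , e∈ , a<e , e<b =
            contradiction (chord-around P-face spP a≤y z≤b x∈P y<x x<z Dyz) notEnds
      where
      notEnds : ¬ (y ≼ a × b ≼ z)
      notEnds (y≤a , b≤z) = gap e e∈ (≤-<-trans y≤a a<e , <-≤-trans e<b b≤z)
      Dyz : T (D Δ y z)
      Dyz = edge⇒D (edges y z (y∈ , z∈ , <-trans y<x x<z , inj₁ gap)) y<x x<z
        λ (y≡0 , z≡m) → notEnds (subst (_≤ toℕ a) (sym y≡0) z≤n , ≤-pred (subst (toℕ b <_) (sym z≡m) (Fin.toℕ<n b)))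

    abstract
      face-unique : ∀ {S P a b} → Face Δ S → Face Δ P → Span S a b → Span P a b → S ≡ P
      face-unique f g s t = ⊆-antisym (face-⊆ g f t s) (face-⊆ f g s t)


  side-sym : ∀ {i j : Fin m} → Side i j → Side j i
  side-sym (inj₁ e) = inj₂ (inj₁ e)
  side-sym (inj₂ (inj₁ e)) = inj₁ e
  side-sym (inj₂ (inj₂ (inj₁ e))) = inj₂ (inj₂ (inj₂ e))
  side-sym (inj₂ (inj₂ (inj₂ e))) = inj₂ (inj₂ (inj₁ e))

  edge-sym : ∀ (Δ : Dissection m) {i j} → Edge Δ i j → Edge Δ j i
  edge-sym Δ (inj₁ s) = inj₁ (side-sym s)
  edge-sym Δ {i} {j} (inj₂ d) = inj₂ (subst T (D-sym Δ i j) d)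

  triangle : Fin m → Fin m → Fin m → Subset m
  triangle a c b = subset (λ x → (x Fin.≟ a) ⊎-dec (x Fin.≟ c) ⊎-dec (x Fin.≟ b))

  module _ {a c b : Fin m} (a<c : a ≺ c) (c<b : c ≺ b) where

    private
      Corner : Fin m → Set
      Corner x = x ≡ a ⊎ x ≡ c ⊎ x ≡ b

      corner? : ∀ x → Dec (Corner x)
      corner? x = (x Fin.≟ a) ⊎-dec (x Fin.≟ c) ⊎-dec (x Fin.≟ b)

      corner : ∀ {x} → x ∈ triangle a c b → Corner x
      corner = ∈-subset⁻ corner?

      a<b : a ≺ b
      a<b = <-trans a<c c<b

      inRange : ∀ {x} → Corner x → a ≼ x × x ≼ b
      inRange (inj₁ refl) = ≤-refl , <⇒≤ a<b
      inRange (inj₂ (inj₁ refl)) = <⇒≤ a<c , <⇒≤ c<b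
      inRange (inj₂ (inj₂ refl)) = <⇒≤ a<b , ≤-refl

    triangle-span : Span (triangle a c b) a b
    triangle-span = ∈-subset⁺ corner? (inj₁ refl) , ∈-subset⁺ corner? (inj₂ (inj₂ refl)) ,
      λ x x∈ → inRange (corner x∈)

    abstract
      triangle-size : ∣ triangle a c b ∣ ≡ 3
      triangle-size = ≤-antisym (covered⇒∣∣≤length {xs = a ∷ c ∷ b ∷ []} (λ x∈ → listed (corner x∈)))
        (unique⇒length≤∣∣ {xs = a ∷ c ∷ b ∷ []}
          ((≺-irrefl a<c ∷ ≺-irrefl a<b ∷ []) ∷ (≺-irrefl c<b ∷ []) ∷ [] ∷ [])
          (∈-subset⁺ corner? (inj₁ refl) ∷ ∈-subset⁺ corner? (inj₂ (inj₁ refl)) ∷ ∈-subset⁺ corner? (inj₂ (inj₂ refl)) ∷ []))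
        where
        listed : ∀ {x} → Corner x → x List.∈ a ∷ c ∷ b ∷ []
        listed (inj₁ refl) = here refl
        listed (inj₂ (inj₁ refl)) = there (here refl)
        listed (inj₂ (inj₂ refl)) = there (there (here refl))

    abstract
      triangle-face : ∀ Δ → Edge Δ a c → Edge Δ c b → Edge Δ a b → Face Δ (triangle a c b)
      triangle-face Δ ac cb ab = ≤-reflexive (sym triangle-size) ,
        (λ x y (x∈ , y∈ , x<y , _) → edges (corner x∈) (corner y∈) x<y) ,
        (λ x y x∈ y∈ x<y _ → x∈ , y∈ , x<y , consec (corner x∈) (corner y∈) x<y)
        where
        edges : ∀ {x y} → Corner x → Corner y → x ≺ y → Edge Δ x y
        edges (inj₁ refl) (inj₁ refl) lt = contradiction lt (<-irrefl refl)
        edges (inj₁ refl) (inj₂ (inj₁ refl)) lt = ac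
        edges (inj₁ refl) (inj₂ (inj₂ refl)) lt = ab
        edges (inj₂ (inj₁ refl)) (inj₁ refl) lt = contradiction lt (<-asym a<c)
        edges (inj₂ (inj₁ refl)) (inj₂ (inj₁ refl)) lt = contradiction lt (<-irrefl refl)
        edges (inj₂ (inj₁ refl)) (inj₂ (inj₂ refl)) lt = cb
        edges (inj₂ (inj₂ refl)) y∈ lt = contradiction (proj₂ (inRange y∈)) (<⇒≱ lt)
        consec : ∀ {x y} → Corner x → Corner y → x ≺ y →
          (∀ z → z ∈ triangle a c b → ¬ (x ≺ z × z ≺ y)) ⊎ (∀ z → z ∈ triangle a c b → x ≼ z × z ≼ y)
        consec (inj₁ refl) (inj₁ refl) lt = contradiction lt (<-irrefl refl)
        consec (inj₁ refl) (inj₂ (inj₁ refl)) lt = inj₁ λ z z∈ → gap (corner z∈)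
          where
          gap : ∀ {z} → Corner z → ¬ (a ≺ z × z ≺ c)
          gap (inj₁ refl) (p , _) = <-irrefl refl p
          gap (inj₂ (inj₁ refl)) (_ , p) = <-irrefl refl p
          gap (inj₂ (inj₂ refl)) (_ , p) = <-asym c<b p
        consec (inj₁ refl) (inj₂ (inj₂ refl)) lt = inj₂ λ z z∈ → inRange (corner z∈)
        consec (inj₂ (inj₁ refl)) (inj₁ refl) lt = contradiction lt (<-asym a<c)
        consec (inj₂ (inj₁ refl)) (inj₂ (inj₁ refl)) lt = contradiction lt (<-irrefl refl)
        consec (inj₂ (inj₁ refl)) (inj₂ (inj₂ refl)) lt = inj₁ λ z z∈ → gap (corner z∈)
          where
          gap : ∀ {z} → Corner z → ¬ (c ≺ z × z ≺ b)
          gap (inj₁ refl) (p , _) = <-asym a<c p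
          gap (inj₂ (inj₁ refl)) (p , _) = <-irrefl refl p
          gap (inj₂ (inj₂ refl)) (_ , p) = <-irrefl refl p
        consec (inj₂ (inj₂ refl)) y∈ lt = contradiction (proj₂ (inRange y∈)) (<⇒≱ lt)

  abstract
    apex : ∀ {Δ : Dissection m} {S a b} → Face Δ S → Span S a b → ∣ S ∣ ≡ 3 →
      ∃ λ c → a ≺ c × c ≺ b × Edge Δ a c × Edge Δ c b
    apex {Δ} {S} {a} {b} (3≤ , edges , _) sp@(a∈ , b∈ , _) size with between 3≤ sp
    ... | c , c∈ , a<c , c<b = c , a<c , c<b ,
          edges a c (a∈ , c∈ , a<c , inj₁ λ d d∈ (a<d , d<c) → four a∈ d∈ c∈ b∈ a<d d<c c<b) ,
          edges c b (c∈ , b∈ , c<b , inj₁ λ d d∈ (c<d , d<b) → four a∈ c∈ d∈ b∈ a<c c<d d<b)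
      where
      four : ∀ {w x y z} → w ∈ S → x ∈ S → y ∈ S → z ∈ S → w ≺ x → x ≺ y → ¬ (y ≺ z)
      four {w} {x} {y} {z} w∈ x∈ y∈ z∈ w<x x<y y<z = contradiction
        (subst (4 ≤_) size (unique⇒length≤∣∣ {xs = w ∷ x ∷ y ∷ z ∷ []}
          ((≺-irrefl w<x ∷ ≺-irrefl (<-trans w<x x<y) ∷ ≺-irrefl (<-trans w<x (<-trans x<y y<z)) ∷ [])
            ∷ (≺-irrefl x<y ∷ ≺-irrefl (<-trans x<y y<z) ∷ []) ∷ (≺-irrefl y<z ∷ []) ∷ [] ∷ [])
          (w∈ ∷ x∈ ∷ y∈ ∷ z∈ ∷ [])))
        1+n≰n

  -- The vertices of the face under the edge ij are those not cut off from ij by another diagonal.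
  module _ (Δ : Dissection m) {i j : Fin m} (ij : Edge Δ i j) (i+1<j : suc (toℕ i) < toℕ j) where

    private
      Visible : Fin m → Set
      Visible x = i ≼ x × x ≼ j ×
        (∀ p q → T (D Δ p q) → i ≼ p → p ≺ x → x ≺ q → q ≼ j → p ≡ i × q ≡ j)

      visible? : ∀ x → Dec (Visible x)
      visible? x = (toℕ i ≤? toℕ x) ×-dec (toℕ x ≤? toℕ j) ×-dec
        all? λ p → all? λ q → T? (D Δ p q) →-dec ((toℕ i ≤? toℕ p) →-dec ((toℕ p <? toℕ x) →-dec
          ((toℕ x <? toℕ q) →-dec ((toℕ q ≤? toℕ j) →-dec ((p Fin.≟ i) ×-dec (q Fin.≟ j))))))

      i<j : i ≺ j
      i<j = <-trans (n<1+n _) i+1<j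

      i∈ : Visible i
      i∈ = ≤-refl , <⇒≤ i<j , λ p q _ i≤p p<i _ _ → contradiction i≤p (<⇒≱ p<i)

      j∈ : Visible j
      j∈ = <⇒≤ i<j , ≤-refl , λ p q _ _ _ j<q q≤j → contradiction q≤j (<⇒≱ j<q)

      successor : ∀ {a b : Fin m} → a ≺ b → ∃ λ (s : Fin m) → toℕ s ≡ suc (toℕ a)
      successor {a} {b} a<b = fromℕ< s<m , Fin.toℕ-fromℕ< s<m
        where s<m = ≤-<-trans a<b (Fin.toℕ<n b)

      -- Take the longest admissible edge `ax` with `x ≼ b`. A diagonal over `x` that starts before
      -- `a` also hides `a`; one that starts after `a` crosses `ax`; one that starts at `a` hides
      -- `b` or is itself a longer choice. The last clause bars `ij` as a choice, so that the face
      -- acquires a third vertex.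
      next : ∀ {a b} → Visible a → Visible b → a ≺ b →
        ∃ λ x → Visible x × a ≺ x × x ≼ b × Edge Δ a x × (a ≡ i × x ≡ j → suc (toℕ a) ≡ toℕ x)
      next {a} {b} (i≤a , a≤j , visA) (i≤b , b≤j , visB) a<b with successor a<b
      ... | s , s≡ with greatest (λ x → (toℕ a <? toℕ x) ×-dec (toℕ x ≤? toℕ b) ×-dec edge? Δ a x ×-dec
                          (((a Fin.≟ i) ×-dec (x Fin.≟ j)) →-dec (suc (toℕ a) ≟ toℕ x)))
                        {s} (≤-reflexive (sym s≡) , subst (_≤ toℕ b) (sym s≡) a<b , inj₁ (inj₁ s≡) , λ _ → sym s≡)
      ...   | x , (a<x , x≤b , ax , proper) , _ , top = x , (≤-trans i≤a (<⇒≤ a<x) , ≤-trans x≤b b≤j , vis) , a<x , x≤b , ax , proper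
        where
        vis : ∀ p q → T (D Δ p q) → i ≼ p → p ≺ x → x ≺ q → q ≼ j → p ≡ i × q ≡ j
        vis p q d i≤p p<x x<q q≤j with <-cmp (toℕ p) (toℕ a)
        ... | tri< p<a _ _ = visA p q d i≤p p<a (<-trans a<x x<q) q≤j
        ... | tri> _ _ a<p = contradiction (a<p , p<x , x<q) (D-noncr Δ a x p q
                (edge⇒D Δ ax a<p p<x λ (_ , x≡m) → <⇒≱ (Fin.toℕ<n q) (subst (_≤ toℕ q) x≡m x<q)) d)
        ... | tri≈ _ p≡a _ with Fin.toℕ-injective p≡a | toℕ q ≤? toℕ b
        ...   | refl | no q≰b = visB p q d i≤p (<-≤-trans p<x x≤b) (≰⇒> q≰b) q≤j
        ...   | refl | yes q≤b with p Fin.≟ i | q Fin.≟ j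
        ...     | yes p≡i | yes q≡j = p≡i , q≡j
        ...     | no p≢i | _ = contradiction (top q (<-trans a<x x<q , q≤b , inj₂ d , λ (e , _) → contradiction e p≢i)) (<⇒≱ x<q)
        ...     | _ | no q≢j = contradiction (top q (<-trans a<x x<q , q≤b , inj₂ d , λ (_ , e) → contradiction e q≢j)) (<⇒≱ x<q)

      face : Subset m
      face = subset visible?

      face-span : Span face i j
      face-span = ∈-subset⁺ visible? i∈ , ∈-subset⁺ visible? j∈ ,
        λ c c∈ → let vis = ∈-subset⁻ visible? c∈ in proj₁ vis , proj₁ (proj₂ vis)

    abstract
      edge-face : ∃ λ S → Face Δ S × Span S i j
      edge-face = face , (big , edges , uncut) , face-span
        where
        big : 3 ≤ ∣ face ∣
        big with next i∈ j∈ i<j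
        ... | x , x∈ , i<x , x≤j , _ , proper = unique⇒length≤∣∣ {xs = i ∷ x ∷ j ∷ []}
                ((≺-irrefl i<x ∷ ≺-irrefl i<j ∷ []) ∷ (≺-irrefl x<j ∷ []) ∷ [] ∷ [])
                (∈-subset⁺ visible? i∈ ∷ ∈-subset⁺ visible? x∈ ∷ ∈-subset⁺ visible? j∈ ∷ [])
          where
          x<j : x ≺ j
          x<j = ≼∧≢⇒≺ x≤j λ { refl → <⇒≢ i+1<j (proper (refl , refl)) }
        edges : ∀ a b → ConsecIn face a b → Edge Δ a b
        edges a b (a∈ , b∈ , a<b , inj₂ all) with
            Fin.toℕ-injective (≤-antisym (proj₁ (all i (proj₁ face-span))) (proj₁ (proj₂ (proj₂ face-span) a a∈)))
          | Fin.toℕ-injective (≤-antisym (proj₂ (proj₂ (proj₂ face-span) b b∈)) (proj₂ (all j (proj₁ (proj₂ face-span)))))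
        ... | refl | refl = ij
        edges a b (a∈ , b∈ , a<b , inj₁ none) with (a Fin.≟ i) ×-dec (b Fin.≟ j)
        ... | yes (refl , refl) = ij
        ... | no ¬ij with next (∈-subset⁻ visible? a∈) (∈-subset⁻ visible? b∈) a<b
        ...   | x , x∈ , a<x , x≤b , ax , _ with x Fin.≟ b
        ...     | yes refl = ax
        ...     | no x≢b = contradiction (a<x , ≼∧≢⇒≺ x≤b x≢b) (none x (∈-subset⁺ visible? x∈))
        uncut : ∀ a b → a ∈ face → b ∈ face → a ≺ b → T (D Δ a b) → ConsecIn face a b
        uncut a b a∈ b∈ a<b d with (a Fin.≟ i) ×-dec (b Fin.≟ j)
        ... | yes (refl , refl) = a∈ , b∈ , a<b , inj₂ (proj₂ (proj₂ face-span))
        ... | no ¬ij = a∈ , b∈ , a<b , inj₁ λ c c∈ (a<c , c<b) → ¬ij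
                (proj₂ (proj₂ (∈-subset⁻ visible? c∈)) a b d (proj₁ (proj₂ (proj₂ face-span) a a∈)) a<c c<b
                  (proj₂ (proj₂ (proj₂ face-span) b b∈)))

-- Rotations

module _ {M : ℕ} where

  data RotView (i : Fin (suc M)) : Set where
    step : toℕ (rot i) ≡ suc (toℕ i) → RotView i
    wrap : toℕ i ≡ M → toℕ (rot i) ≡ 0 → RotView i

  rotView : ∀ i → RotView i
  rotView i with m≤n⇒m<n∨m≡n (≤-pred (Fin.toℕ<n i))
  ... | inj₁ i<M = step (trans (Fin.toℕ-fromℕ< (m%n<n (suc (toℕ i)) (suc M))) (m<n⇒m%n≡m (s≤s i<M)))
  ... | inj₂ i≡M = wrap i≡M (trans (Fin.toℕ-fromℕ< (m%n<n (suc (toℕ i)) (suc M)))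
                               (trans (cong (λ z → suc z % suc M) i≡M) (n%n≡0 (suc M))))

  rot-surjective : ∀ (j : Fin (suc M)) → ∃ λ i → rot i ≡ j
  rot-surjective zero with rotView (fromℕ M)
  ... | wrap _ q = fromℕ M , Fin.toℕ-injective q
  ... | step p = contradiction (subst (_< suc M) (trans p (cong suc (Fin.toℕ-fromℕ M))) (Fin.toℕ<n (rot (fromℕ M)))) 1+n≰n
  rot-surjective (suc j) with rotView (inject₁ j)
  ... | step p = inject₁ j , Fin.toℕ-injective (trans p (cong suc (Fin.toℕ-inject₁ j)))
  ... | wrap p _ = contradiction (subst (_< M) (trans (sym (Fin.toℕ-inject₁ j)) p) (Fin.toℕ<n j)) 1+n≰n

  side-rot : ∀ {i j : Fin (suc M)} → Side i j → Side (rot i) (rot j)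
  side-rot {i} {j} = λ
    { (inj₁ e) → next e
    ; (inj₂ (inj₁ e)) → side-sym (next e)
    ; (inj₂ (inj₂ (inj₁ (e , e′)))) → ends e e′
    ; (inj₂ (inj₂ (inj₂ (e , e′)))) → side-sym (ends e e′) }
    where
    next : ∀ {i j : Fin (suc M)} → toℕ j ≡ suc (toℕ i) → Side (rot i) (rot j)
    next {i} {j} e with rotView i | rotView j
    ... | step p | step q = inj₁ (trans q (cong suc (trans e (sym p))))
    ... | step p | wrap q q′ = inj₂ (inj₂ (inj₂ (q′ , cong suc (trans p (trans (sym e) q)))))
    ... | wrap p _ | _ = contradiction (subst (_< suc M) (trans e (cong suc p)) (Fin.toℕ<n j)) 1+n≰n
    ends : ∀ {i j : Fin (suc M)} → toℕ i ≡ 0 → suc (toℕ j) ≡ suc M → Side (rot i) (rot j)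
    ends {i} {j} e e′ with rotView i | rotView j
    ... | step p | wrap _ q = inj₂ (inj₁ (trans p (cong suc (trans e (sym q)))))
    ... | wrap p p′ | wrap q q′ = inj₂ (inj₂ (inj₁ (p′ , cong suc (trans q′ (trans (sym e) p)))))
    ... | _ | step q = contradiction (subst (_< suc M) (trans q e′) (Fin.toℕ<n (rot j))) 1+n≰n

  side-unrot : ∀ {i j : Fin (suc M)} → Side (rot i) (rot j) → Side i j
  side-unrot {i} {j} = λ
    { (inj₁ e) → next e
    ; (inj₂ (inj₁ e)) → side-sym (next e)
    ; (inj₂ (inj₂ (inj₁ (e , e′)))) → ends e e′
    ; (inj₂ (inj₂ (inj₂ (e , e′)))) → side-sym (ends e e′) }
    where
    next : ∀ {i j : Fin (suc M)} → toℕ (rot j) ≡ suc (toℕ (rot i)) → Side i j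
    next {i} {j} e with rotView i | rotView j
    ... | _ | wrap _ q = contradiction (trans (sym q) e) λ ()
    ... | step p | step q = inj₁ (trans (suc-injective (trans (sym q) e)) p)
    ... | wrap p p′ | step q = inj₂ (inj₂ (inj₂ (trans (suc-injective (trans (sym q) e)) p′ , cong suc p)))
    ends : ∀ {i j : Fin (suc M)} → toℕ (rot i) ≡ 0 → suc (toℕ (rot j)) ≡ suc M → Side i j
    ends {i} {j} e e′ with rotView i | rotView j
    ... | step p | _ = contradiction (trans (sym e) p) λ ()
    ... | wrap p _ | step q = inj₂ (inj₁ (trans p (trans (sym (suc-injective e′)) q)))
    ... | wrap p _ | wrap q q′ = inj₂ (inj₂ (inj₁ (trans p (trans (sym (suc-injective e′)) q′) , cong suc q)))

  -- The pullback along `rot`, which moves the dissection one step back.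
  rotDiss : Dissection (suc M) → Dissection (suc M)
  rotDiss Δ = record
    { D = λ i j → D Δ (rot i) (rot j)
    ; D-sym = λ i j → D-sym Δ (rot i) (rot j)
    ; D-diag = λ i j d → (λ e → proj₁ (D-diag Δ _ _ d) (cong (toℕ ∘ rot) (Fin.toℕ-injective e))) ,
                         (λ s → proj₂ (D-diag Δ _ _ d) (side-rot s))
    ; D-noncr = noncr }
    where
    noncr : ∀ a b c d → T (D Δ (rot a) (rot b)) → T (D Δ (rot c) (rot d)) → ¬ Cross a b c d
    noncr a b c d ab cd (a<c , c<b , b<d) with rotView a | rotView b | rotView c | rotView d
    ... | wrap p _ | _ | _ | _ = contradiction (Fin.toℕ<n c) (≤⇒≯ (subst (_< toℕ c) p a<c))
    ... | _ | wrap p _ | _ | _ = contradiction (Fin.toℕ<n d) (≤⇒≯ (subst (_< toℕ d) p b<d))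
    ... | _ | _ | wrap p _ | _ = contradiction (Fin.toℕ<n b) (≤⇒≯ (subst (_< toℕ b) p c<b))
    ... | step p | step q | step r | step s = D-noncr Δ _ _ _ _ ab cd
          (subst₂ _<_ (sym p) (sym r) (s≤s a<c) , subst₂ _<_ (sym r) (sym q) (s≤s c<b) , subst₂ _<_ (sym q) (sym s) (s≤s b<d))
    -- Only the largest vertex `d` can wrap. It becomes 0, so the crossing now reads `d`, `a`, `c`,
    -- `b` and the chord `dc` comes first.
    ... | step p | step q | step r | wrap _ s = D-noncr Δ _ _ _ _ (subst T (D-sym Δ _ _) cd) ab
          (subst₂ _<_ (sym s) (sym p) (s≤s z≤n) , subst₂ _<_ (sym p) (sym r) (s≤s a<c) , subst₂ _<_ (sym r) (sym q) (s≤s c<b))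

  edge-rot : ∀ {Δ i j} → Edge (rotDiss Δ) i j → Edge Δ (rot i) (rot j)
  edge-rot = [ inj₁ ∘ side-rot , inj₂ ]′

  edge-unrot : ∀ {Δ i j} → Edge Δ (rot i) (rot j) → Edge (rotDiss Δ) i j
  edge-unrot = [ inj₁ ∘ side-unrot , inj₂ ]′

  -- The preimage under `rot`, as a cyclic shift of the characteristic vector.
  rotSubset : Subset (suc M) → Subset (suc M)
  rotSubset (x ∷ xs) = xs ∷ʳ x

lookup-∷ʳ-suc : ∀ {A : Set} {n} x (xs : Vec A n) i j → toℕ j ≡ suc (toℕ i) → lookup (xs ∷ʳ x) i ≡ lookup (x ∷ xs) j
lookup-∷ʳ-suc x (y ∷ ys) zero (suc zero) _ = refl
lookup-∷ʳ-suc x (y ∷ ys) (suc i) (suc (suc j)) e = lookup-∷ʳ-suc x ys i (suc j) (suc-injective e)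
lookup-∷ʳ-suc x [] zero (suc ()) _

lookup-∷ʳ-last : ∀ {A : Set} {n} x (xs : Vec A n) i → toℕ i ≡ n → lookup (xs ∷ʳ x) i ≡ x
lookup-∷ʳ-last x [] zero _ = refl
lookup-∷ʳ-last x (y ∷ ys) (suc i) e = lookup-∷ʳ-last x ys i (suc-injective e)

∣∷ʳ∣ : ∀ {n} x (xs : Subset n) → ∣ xs ∷ʳ x ∣ ≡ ∣ x ∷ xs ∣
∣∷ʳ∣ x [] = refl
∣∷ʳ∣ inside (inside ∷ xs) = cong suc (∣∷ʳ∣ inside xs)
∣∷ʳ∣ inside (outside ∷ xs) = ∣∷ʳ∣ inside xs
∣∷ʳ∣ outside (inside ∷ xs) = cong suc (∣∷ʳ∣ outside xs)
∣∷ʳ∣ outside (outside ∷ xs) = ∣∷ʳ∣ outside xs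

module _ {M : ℕ} where

  ∣rotSubset∣ : ∀ (S : Subset (suc M)) → ∣ rotSubset S ∣ ≡ ∣ S ∣
  ∣rotSubset∣ (x ∷ xs) = ∣∷ʳ∣ x xs

  lookup-rotSubset : ∀ (S : Subset (suc M)) i → lookup (rotSubset S) i ≡ lookup S (rot i)
  lookup-rotSubset (x ∷ xs) i with rotView i
  ... | step p = lookup-∷ʳ-suc x xs i (rot i) p
  ... | wrap p q = trans (lookup-∷ʳ-last x xs i p) (cong (lookup (x ∷ xs)) (sym (Fin.toℕ-injective {j = zero} q)))

  rotSubset-surjective : ∀ (S′ : Subset (suc M)) → ∃ λ S → S′ ≡ rotSubset S
  rotSubset-surjective S′ with initLast S′
  ... | xs , x , eq = x ∷ xs , eq

  -- The two alternatives of `ConsecIn`, separated because a rotation that carries an end of the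
  -- pair across 0 exchanges them and reverses the order of the pair.
  Closing Gap : Subset (suc M) → Fin (suc M) → Fin (suc M) → Set
  Closing S a b = a ∈ S × b ∈ S × a ≺ b × (∀ c → c ∈ S → a ≼ c × c ≼ b)
  Gap S a b = a ∈ S × b ∈ S × a ≺ b × (∀ c → c ∈ S → ¬ (a ≺ c × c ≺ b))

  closing⇒consec : ∀ {S a b} → Closing S a b → ConsecIn S a b
  closing⇒consec (a∈ , b∈ , lt , all) = a∈ , b∈ , lt , inj₂ all

  gap⇒consec : ∀ {S a b} → Gap S a b → ConsecIn S a b
  gap⇒consec (a∈ , b∈ , lt , none) = a∈ , b∈ , lt , inj₁ none

  module _ {S : Subset (suc M)} where

    private
      S′ = rotSubset S

    ∈-rot⁺ : ∀ {x} → x ∈ S′ → rot x ∈ S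
    ∈-rot⁺ {x} x∈ = lookup⇒[]= _ S (trans (sym (lookup-rotSubset S x)) ([]=⇒lookup x∈))

    ∈-rot⁻ : ∀ {x} → rot x ∈ S → x ∈ S′
    ∈-rot⁻ {x} x∈ = lookup⇒[]= _ S′ (trans (lookup-rotSubset S x) ([]=⇒lookup x∈))

    private
      forall-rot : {P : Fin (suc M) → Set} → (∀ c → c ∈ S′ → P (rot c)) → ∀ c → c ∈ S → P c
      forall-rot h c c∈ with rot-surjective c
      ... | c′ , refl = h c′ (∈-rot⁻ c∈)

    consec-rot : ∀ {a b} → ConsecIn S′ a b → ConsecIn S (rot a) (rot b) ⊎ ConsecIn S (rot b) (rot a)
    consec-rot {a} {b} (a∈ , b∈ , a<b , alt) with rotView a | rotView b
    ... | wrap p _ | _ = contradiction (Fin.toℕ<n b) (≤⇒≯ (subst (_< toℕ b) p a<b))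
    ... | step p | step q = inj₁ (∈-rot⁺ a∈ , ∈-rot⁺ b∈ , subst₂ _<_ (sym p) (sym q) (s≤s a<b) , alts alt)
      where
      alts : _ → _
      alts (inj₁ none) = inj₁ (forall-rot none′)
        where
        none′ : ∀ c → c ∈ S′ → ¬ (rot a ≺ rot c × rot c ≺ rot b)
        none′ c c∈ (lo , hi) with rotView c
        ... | step r = none c c∈ (≤-pred (subst₂ _<_ p r lo) , ≤-pred (subst₂ _<_ r q hi))
        ... | wrap _ r = n≮0 (subst (_ <_) r lo)
      alts (inj₂ all) = inj₂ (forall-rot all′)
        where
        all′ : ∀ c → c ∈ S′ → rot a ≼ rot c × rot c ≼ rot b
        all′ c c∈ with rotView c
        ... | step r = subst₂ _≤_ (sym p) (sym r) (s≤s (proj₁ (all c c∈))) , subst₂ _≤_ (sym r) (sym q) (s≤s (proj₂ (all c c∈)))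
        ... | wrap r _ = contradiction (subst (_< suc M) q (Fin.toℕ<n (rot b))) (≤⇒≯ (s≤s (subst (_≤ toℕ b) r (proj₂ (all c c∈)))))
    ... | step p | wrap q q′ = inj₂ (∈-rot⁺ b∈ , ∈-rot⁺ a∈ , subst₂ _<_ (sym q′) (sym p) (s≤s z≤n) , alts alt)
      where
      alts : _ → _
      alts (inj₁ none) = inj₂ (forall-rot all′)
        where
        all′ : ∀ c → c ∈ S′ → rot b ≼ rot c × rot c ≼ rot a
        all′ c c∈ with rotView c
        ... | wrap _ r = subst₂ _≤_ (sym q′) (sym r) z≤n , subst₂ _≤_ (sym r) (sym p) z≤n
        ... | step r = subst (_≤ toℕ (rot c)) (sym q′) z≤n , subst₂ _≤_ (sym r) (sym p) (s≤s (≮⇒≥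
              λ a<c → none c c∈ (a<c , subst (toℕ c <_) (sym q) (≤-pred (subst (_< suc M) r (Fin.toℕ<n (rot c)))))))
      alts (inj₂ all) = inj₁ (forall-rot none′)
        where
        none′ : ∀ c → c ∈ S′ → ¬ (rot b ≺ rot c × rot c ≺ rot a)
        none′ c c∈ (lo , hi) with rotView c
        ... | step r = <⇒≱ (≤-pred (subst₂ _<_ r p hi)) (proj₁ (all c c∈))
        ... | wrap _ r = n≮0 (subst (_ <_) r lo)

    closing-unrot : ∀ {a b} → toℕ (rot a) ≡ suc (toℕ a) → Closing S (rot a) (rot b) → Closing S′ a b
    closing-unrot {a} {b} p (a∈ , b∈ , a<b , all) with rotView b
    ... | wrap _ q = contradiction (subst (_ <_) q a<b) n≮0
    ... | step q = ∈-rot⁻ a∈ , ∈-rot⁻ b∈ , ≤-pred (subst₂ _<_ p q a<b) , all′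
      where
      all′ : ∀ c → c ∈ S′ → a ≼ c × c ≼ b
      all′ c c∈ with rotView c | all (rot c) (∈-rot⁺ c∈)
      ... | step r | lo , hi = ≤-pred (subst₂ _≤_ p r lo) , ≤-pred (subst₂ _≤_ r q hi)
      ... | wrap _ r | lo , _ = contradiction (subst₂ _≤_ p r lo) λ ()

    gap-unrot : ∀ {a b} → toℕ (rot a) ≡ suc (toℕ a) → Gap S (rot a) (rot b) → Gap S′ a b
    gap-unrot {a} {b} p (a∈ , b∈ , a<b , none) with rotView b
    ... | wrap _ q = contradiction (subst (_ <_) q a<b) n≮0
    ... | step q = ∈-rot⁻ a∈ , ∈-rot⁻ b∈ , ≤-pred (subst₂ _<_ p q a<b) , none′
      where
      none′ : ∀ c → c ∈ S′ → ¬ (a ≺ c × c ≺ b)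
      none′ c c∈ (a<c , c<b) with rotView c
      ... | step r = none (rot c) (∈-rot⁺ c∈) (subst₂ _<_ (sym p) (sym r) (s≤s a<c) , subst₂ _<_ (sym r) (sym q) (s≤s c<b))
      ... | wrap r _ = contradiction (Fin.toℕ<n b) (≤⇒≯ (subst (_< toℕ b) r c<b))

    private
      below-wrap : ∀ {a b} → toℕ a ≡ M → toℕ (rot b) ≡ suc (toℕ b) → b ≺ a
      below-wrap {a} {b} p q = subst (toℕ b <_) (sym p) (≤-pred (subst (_< suc M) q (Fin.toℕ<n (rot b))))

    gap-unrot-wrap : ∀ {a b} → toℕ a ≡ M → toℕ (rot a) ≡ 0 → Gap S (rot a) (rot b) → Closing S′ b a
    gap-unrot-wrap {a} {b} p p′ (a∈ , b∈ , a<b , none) with rotView b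
    ... | wrap _ q = contradiction (subst (_ <_) q a<b) n≮0
    ... | step q = ∈-rot⁻ b∈ , ∈-rot⁻ a∈ , below-wrap p q , all′
      where
      all′ : ∀ c → c ∈ S′ → b ≼ c × c ≼ a
      all′ c c∈ with rotView c
      ... | wrap r _ = <⇒≤ (below-wrap r q) , ≤-reflexive (trans r (sym p))
      ... | step r = ≮⇒≥ (λ c<b → none (rot c) (∈-rot⁺ c∈)
                (subst₂ _<_ (sym p′) (sym r) (s≤s z≤n) , subst₂ _<_ (sym r) (sym q) (s≤s c<b))) ,
              <⇒≤ (below-wrap p r)

    closing-unrot-wrap : ∀ {a b} → toℕ a ≡ M → toℕ (rot a) ≡ 0 → Closing S (rot a) (rot b) → Gap S′ b a
    closing-unrot-wrap {a} {b} p p′ (a∈ , b∈ , a<b , all) with rotView b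
    ... | wrap _ q = contradiction (subst (_ <_) q a<b) n≮0
    ... | step q = ∈-rot⁻ b∈ , ∈-rot⁻ a∈ , below-wrap p q , none′
      where
      none′ : ∀ c → c ∈ S′ → ¬ (b ≺ c × c ≺ a)
      none′ c c∈ (b<c , c<a) with rotView c
      ... | wrap r _ = <-irrefl (trans r (sym p)) c<a
      ... | step r = <⇒≱ b<c (≤-pred (subst₂ _≤_ r q (proj₂ (all (rot c) (∈-rot⁺ c∈)))))

    consec-unrot : ∀ {a b} → ConsecIn S (rot a) (rot b) → ConsecIn S′ a b ⊎ ConsecIn S′ b a
    consec-unrot {a} (a∈ , b∈ , lt , alt) with rotView a
    consec-unrot (a∈ , b∈ , lt , inj₁ none) | step p = inj₁ (gap⇒consec (gap-unrot p (a∈ , b∈ , lt , none)))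
    consec-unrot (a∈ , b∈ , lt , inj₂ all) | step p = inj₁ (closing⇒consec (closing-unrot p (a∈ , b∈ , lt , all)))
    consec-unrot (a∈ , b∈ , lt , inj₁ none) | wrap p p′ = inj₂ (closing⇒consec (gap-unrot-wrap p p′ (a∈ , b∈ , lt , none)))
    consec-unrot (a∈ , b∈ , lt , inj₂ all) | wrap p p′ = inj₂ (gap⇒consec (closing-unrot-wrap p p′ (a∈ , b∈ , lt , all)))

    module _ {Δ : Dissection (suc M)} where

      face-rot : Face (rotDiss Δ) S′ → Face Δ S
      face-rot (3≤ , edges , uncut) = subst (3 ≤_) (∣rotSubset∣ S) 3≤ , edges′ , uncut′
        where
        edges′ : ∀ x y → ConsecIn S x y → Edge Δ x y
        edges′ x y xy with rot-surjective x | rot-surjective y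
        ... | a , refl | b , refl with consec-unrot xy
        ...   | inj₁ ab = edge-rot {Δ = Δ} (edges a b ab)
        ...   | inj₂ ba = edge-sym Δ (edge-rot {Δ = Δ} (edges b a ba))
        uncut′ : ∀ x y → x ∈ S → y ∈ S → x ≺ y → T (D Δ x y) → ConsecIn S x y
        uncut′ x y x∈ y∈ x<y d with rot-surjective x | rot-surjective y
        ... | a , refl | b , refl with <-cmp (toℕ a) (toℕ b)
        ...   | tri≈ _ e _ = contradiction (cong (toℕ ∘ rot) (Fin.toℕ-injective e)) (<⇒≢ x<y)
        ...   | tri< a<b _ _ with consec-rot (uncut a b (∈-rot⁻ x∈) (∈-rot⁻ y∈) a<b d)
        ...     | inj₁ c = c
        ...     | inj₂ (_ , _ , y<x , _) = contradiction x<y (<-asym y<x)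
        uncut′ x y x∈ y∈ x<y d | a , refl | b , refl | tri> _ _ b<a
          with consec-rot (uncut b a (∈-rot⁻ y∈) (∈-rot⁻ x∈) b<a (subst T (D-sym Δ _ _) d))
        ...     | inj₂ c = c
        ...     | inj₁ (_ , _ , y<x , _) = contradiction x<y (<-asym y<x)

      face-unrot : Face Δ S → Face (rotDiss Δ) S′
      face-unrot (3≤ , edges , uncut) = subst (3 ≤_) (sym (∣rotSubset∣ S)) 3≤ , edges′ , uncut′
        where
        edges′ : ∀ a b → ConsecIn S′ a b → Edge (rotDiss Δ) a b
        edges′ a b ab with consec-rot ab
        ... | inj₁ c = edge-unrot {Δ = Δ} (edges _ _ c)
        ... | inj₂ c = edge-unrot {Δ = Δ} (edge-sym Δ (edges _ _ c))
        uncut′ : ∀ a b → a ∈ S′ → b ∈ S′ → a ≺ b → T (D Δ (rot a) (rot b)) → ConsecIn S′ a b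
        uncut′ a b a∈ b∈ a<b d with <-cmp (toℕ (rot a)) (toℕ (rot b))
        ... | tri≈ _ e _ = contradiction e (proj₁ (D-diag Δ _ _ d))
        ... | tri< lt _ _ with consec-unrot (uncut _ _ (∈-rot⁺ a∈) (∈-rot⁺ b∈) lt d)
        ...   | inj₁ c = c
        ...   | inj₂ (_ , _ , b<a , _) = contradiction a<b (<-asym b<a)
        uncut′ a b a∈ b∈ a<b d | tri> _ _ gt
          with consec-unrot (uncut _ _ (∈-rot⁺ b∈) (∈-rot⁺ a∈) gt (subst T (D-sym Δ _ _) d))
        ...   | inj₂ c = c
        ...   | inj₁ (_ , _ , b<a , _) = contradiction a<b (<-asym b<a)

-- Rotating marked dissections into canonical position

module _ {r M : ℕ} where

  -- The new marked edge is an argument because its ends may have to be swapped; `rotated-suc`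
  -- records how it relates to the old one.
  rotate : (X : MarkedDiss r (suc M)) → ∀ {a b} → ConsecIn (rotSubset (rgon X)) a b → MarkedDiss r (suc M)
  rotate X {a} {b} ab = record
    { diss = rotDiss (diss X)
    ; rgon = rotSubset (rgon X)
    ; rgon-face = face-unrot {Δ = diss X} (rgon-face X)
    ; rgon-size = trans (∣rotSubset∣ (rgon X)) (rgon-size X)
    ; others = others′
    ; e₁ = a
    ; e₂ = b
    ; edge = ab }
    where
    others′ : ∀ S′ → Face (rotDiss (diss X)) S′ → ∣ S′ ∣ ≡ 3 ⊎ S′ ≡ rotSubset (rgon X)
    others′ S′ f with rotSubset-surjective S′
    ... | S , refl with others X S (face-rot {Δ = diss X} f)
    ...   | inj₁ size = inj₁ (trans (∣rotSubset∣ S) size)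
    ...   | inj₂ refl = inj₂ refl

  -- `X′` is the pullback of `X` along `t` rotations, so `X′ ≈rot X`. The polygon is tracked as
  -- well, since `≈rot` mentions only diagonals and the marked edge.
  record Rotated (t : ℕ) (X X′ : MarkedDiss r (suc M)) : Set where
    constructor rotated
    field
      sameD : ∀ i j → D (diss X′) i j ≡ D (diss X) (rotBy t i) (rotBy t j)
      rgon⇒ : ∀ {i} → i ∈ rgon X′ → rotBy t i ∈ rgon X
      rgon⇐ : ∀ {i} → rotBy t i ∈ rgon X → i ∈ rgon X′
      sameEdge : SamePair (rotBy t (e₁ X′)) (rotBy t (e₂ X′)) (e₁ X) (e₂ X)
  open Rotated public

  samePair-map : ∀ (f : Fin (suc M) → Fin (suc M)) {a b c d} → SamePair a b c d → SamePair (f a) (f b) (f c) (f d)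
  samePair-map f (inj₁ (refl , refl)) = inj₁ (refl , refl)
  samePair-map f (inj₂ (refl , refl)) = inj₂ (refl , refl)

  samePair-trans : ∀ {a b c d e f : Fin (suc M)} → SamePair a b c d → SamePair c d e f → SamePair a b e f
  samePair-trans (inj₁ (refl , refl)) q = q
  samePair-trans (inj₂ (refl , refl)) (inj₁ (refl , refl)) = inj₂ (refl , refl)
  samePair-trans (inj₂ (refl , refl)) (inj₂ (refl , refl)) = inj₁ (refl , refl)

  rotated-refl : ∀ X → Rotated 0 X X
  rotated-refl X = rotated (λ _ _ → refl) (λ p → p) (λ p → p) (inj₁ (refl , refl))

  rotated-suc : ∀ {X a b t X′} (ab : ConsecIn (rotSubset (rgon X)) a b) → SamePair (rot a) (rot b) (e₁ X) (e₂ X) →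
    Rotated t (rotate X ab) X′ → Rotated (suc t) X X′
  rotated-suc {X} ab same R = rotated (sameD R) (λ p → ∈-rot⁺ {S = rgon X} (rgon⇒ R p)) (λ p → rgon⇐ R (∈-rot⁻ {S = rgon X} p))
    (samePair-trans (samePair-map rot (sameEdge R)) same)

  rotateBy : ∀ t X → ∃ λ X′ → Rotated t X X′
  rotateBy zero X = X , rotated-refl X
  rotateBy (suc t) X with rot-surjective (e₁ X) | rot-surjective (e₂ X)
  ... | a , pa | b , pb with consec-unrot (subst₂ (ConsecIn (rgon X)) (sym pa) (sym pb) (edge X))
  ...   | inj₁ ab with rotateBy t (rotate X ab)
  ...     | X′ , R = X′ , rotated-suc ab (inj₁ (pa , pb)) R
  rotateBy (suc t) X | a , pa | b , pb | inj₂ ba with rotateBy t (rotate X ba)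
  ...     | X′ , R = X′ , rotated-suc ba (inj₂ (pb , pa)) R

  Canonical : MarkedDiss r (suc M) → Set
  Canonical X = toℕ (e₁ X) ≡ 0 × (∀ c → c ∈ rgon X → c ≼ e₂ X)

  Canonized : MarkedDiss r (suc M) → Set
  Canonized X = ∃ λ t → ∃ λ X′ → Rotated t X X′ × Canonical X′

  canonize-closing : ∀ f X → toℕ (e₁ X) ≡ f → Closing (rgon X) (e₁ X) (e₂ X) → Canonized X
  canonize-closing zero X e (_ , _ , _ , all) = 0 , X , rotated-refl X , e , λ c c∈ → proj₂ (all c c∈)
  canonize-closing (suc f) X e cl with rot-surjective (e₁ X) | rot-surjective (e₂ X)
  ... | a , pa | b , pb with rotView a
  ...   | wrap _ q = contradiction (trans (sym e) (trans (cong toℕ (sym pa)) q)) λ ()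
  ...   | step q with closing-unrot q (subst₂ (Closing (rgon X)) (sym pa) (sym pb) cl)
  ...     | cl′ with canonize-closing f (rotate X (closing⇒consec cl′)) (suc-injective (trans (sym q) (trans (cong toℕ pa) e))) cl′
  ...       | t , X′ , R , can = suc t , X′ , rotated-suc (closing⇒consec cl′) (inj₁ (pa , pb)) R , can

  -- Rotating back lowers the first end until it is 0. One further step sends it to the last vertex,
  -- which turns the gap into a closing pair with its ends swapped.
  canonize-gap : ∀ f X → toℕ (e₁ X) ≡ f → Gap (rgon X) (e₁ X) (e₂ X) → Canonized X
  canonize-gap f X e gp with rot-surjective (e₁ X) | rot-surjective (e₂ X)
  ... | a , pa | b , pb with rotView a | f
  ...   | step q | zero = contradiction (trans (sym e) (trans (cong toℕ (sym pa)) q)) λ ()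
  ...   | wrap q q′ | _ with gap-unrot-wrap q q′ (subst₂ (Gap (rgon X)) (sym pa) (sym pb) gp)
  ...     | cl with canonize-closing _ (rotate X (closing⇒consec cl)) refl cl
  ...       | t , X′ , R , can = suc t , X′ , rotated-suc (closing⇒consec cl) (inj₂ (pb , pa)) R , can
  canonize-gap f X e gp | a , pa | b , pb | step q | suc f′
    with gap-unrot q (subst₂ (Gap (rgon X)) (sym pa) (sym pb) gp)
  ...     | gp′ with canonize-gap f′ (rotate X (gap⇒consec gp′)) (suc-injective (trans (sym q) (trans (cong toℕ pa) e))) gp′
  ...       | t , X′ , R , can = suc t , X′ , rotated-suc (gap⇒consec gp′) (inj₁ (pa , pb)) R , can

  canonize : ∀ X → Canonized X
  canonize X with edge X
  ... | a∈ , b∈ , lt , inj₁ none = canonize-gap _ X refl (a∈ , b∈ , lt , none)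
  ... | a∈ , b∈ , lt , inj₂ all = canonize-closing _ X refl (a∈ , b∈ , lt , all)

-- Triangulations

-- The leaves of a tree are the sides a(a+1), (a+1)(a+2), … of a triangulated polygon whose first
-- vertex is a; each subtree contributes the chord under which its leaves lie.
data Arc : Tree → ℕ → ℕ → ℕ → Set where
  whole : ∀ {t a j} → j ≡ a + leaves t → Arc t a a j
  left  : ∀ {l r a i j} → Arc l a i j → Arc (node l r) a i j
  right : ∀ {l r a i j} → Arc r (a + leaves l) i j → Arc (node l r) a i j

0<leaves : ∀ t → 0 < leaves t
0<leaves leaf = s≤s z≤n
0<leaves (node l r) = <-≤-trans (0<leaves l) (m≤m+n _ _)

leavesˡ< : ∀ l r → leaves l < leaves (node l r)
leavesˡ< l r = m<m+n (leaves l) (0<leaves r)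

arc-bounds : ∀ {t a i j} → Arc t a i j → a ≤ i × i < j × j ≤ a + leaves t
arc-bounds {t} (whole refl) = ≤-refl , m<m+n _ (0<leaves t) , ≤-refl
arc-bounds {node l r} {a} (left A) with arc-bounds A
... | lo , lt , hi = lo , lt , ≤-trans hi (+-monoʳ-≤ a (m≤m+n (leaves l) (leaves r)))
arc-bounds {node l r} {a} (right A) with arc-bounds A
... | lo , lt , hi = ≤-trans (m≤m+n a _) lo , lt , ≤-trans hi (≤-reflexive (+-assoc a (leaves l) (leaves r)))

arc? : ∀ t a i j → Dec (Arc t a i j)
arc? leaf a i j = map′ (λ { (refl , e) → whole e }) (λ { (whole e) → refl , e }) ((a ≟ i) ×-dec (j ≟ a + 1))
arc? (node l r) a i j = map′
  (λ { (inj₁ (refl , e)) → whole e ; (inj₂ (inj₁ A)) → left A ; (inj₂ (inj₂ A)) → right A })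
  (λ { (whole e) → inj₁ (refl , e) ; (left A) → inj₂ (inj₁ A) ; (right A) → inj₂ (inj₂ A) })
  (((a ≟ i) ×-dec (j ≟ a + leaves (node l r))) ⊎-dec (arc? l a i j ⊎-dec arc? r (a + leaves l) i j))

arc-side : ∀ t {a i} → a ≤ i → i < a + leaves t → Arc t a i (suc i)
arc-side leaf {a} {i} lo hi with ≤-antisym lo (≤-pred (subst (i <_) (+-comm a 1) hi))
... | refl = whole (+-comm 1 a)
arc-side (node l r) {a} {i} lo hi with i <? a + leaves l
... | yes lt = left (arc-side l lo lt)
... | no ge = right (arc-side r (≮⇒≥ ge) (subst (i <_) (sym (+-assoc a (leaves l) (leaves r))) hi))

arc-noncrossing : ∀ {t a i j p q} → Arc t a i j → Arc t a p q → ¬ (i < p × p < j × j < q)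
arc-noncrossing (whole refl) B (_ , _ , j<q) = <⇒≱ j<q (proj₂ (proj₂ (arc-bounds B)))
arc-noncrossing A@(left _) (whole _) (i<p , _ , _) = <⇒≱ i<p (proj₁ (arc-bounds A))
arc-noncrossing A@(right _) (whole _) (i<p , _ , _) = <⇒≱ i<p (proj₁ (arc-bounds A))
arc-noncrossing (left A) (left B) c = arc-noncrossing A B c
arc-noncrossing (right A) (right B) c = arc-noncrossing A B c
arc-noncrossing (left A) (right B) (_ , p<j , _) =
  <⇒≱ p<j (≤-trans (proj₂ (proj₂ (arc-bounds A))) (proj₁ (arc-bounds B)))
arc-noncrossing (right A) (left B) (i<p , p<j , j<q) =
  <⇒≱ (<-trans i<p (<-trans p<j j<q)) (≤-trans (proj₂ (proj₂ (arc-bounds B))) (proj₁ (arc-bounds A)))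

arc-apex : ∀ {t a i j} → Arc t a i j → j ≡ suc i ⊎ ∃ λ c → i < c × c < j × Arc t a i c × Arc t a c j
arc-apex {leaf} {a} (whole refl) = inj₁ (+-comm a 1)
arc-apex {node l r} {a} (whole refl) = inj₂ (a + leaves l , m<m+n a (0<leaves l) , +-monoʳ-< a (leavesˡ< l r) ,
  left (whole refl) , right (whole (sym (+-assoc a (leaves l) (leaves r)))))
arc-apex (left A) with arc-apex A
... | inj₁ e = inj₁ e
... | inj₂ (c , lo , hi , B , C) = inj₂ (c , lo , hi , left B , left C)
arc-apex (right A) with arc-apex A
... | inj₁ e = inj₁ e
... | inj₂ (c , lo , hi , B , C) = inj₂ (c , lo , hi , right B , right C)

-- Triangulations are maximal. If `i` and `j` lie on different sides of the apex `a + leaves l`,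
-- then `a < i` gives a crossing with the left child's chord and `j` before the last vertex one with
-- the right child's; otherwise the pair is the whole arc.
arc-maximal : ∀ t {a i j} → a ≤ i → i < j → j ≤ a + leaves t →
  (∀ {p q} → Arc t a p q → ¬ (p < i × i < q × q < j) × ¬ (i < p × p < j × j < q)) → Arc t a i j
arc-maximal leaf {a} {i} {j} lo lt hi nc with ≤-antisym lo (≤-pred (<-≤-trans lt (subst (j ≤_) (+-comm a 1) hi)))
... | refl = whole (≤-antisym hi (subst (_≤ j) (+-comm 1 a) lt))
arc-maximal (node l r) {a} {i} {j} lo lt hi nc with j ≤? a + leaves l | a + leaves l ≤? i
... | yes j≤c | _ = left (arc-maximal l lo lt j≤c (nc ∘ left))
... | no j≰c | yes c≤i = right (arc-maximal r c≤i lt (subst (j ≤_) (sym (+-assoc a (leaves l) (leaves r))) hi) (nc ∘ right))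
... | no j≰c | no c≰i with m≤n⇒m<n∨m≡n lo | m≤n⇒m<n∨m≡n hi
...   | inj₁ a<i | _ = contradiction (a<i , ≰⇒> c≰i , ≰⇒> j≰c) (proj₁ (nc (left (whole refl))))
...   | inj₂ refl | inj₁ j<b = contradiction
          (≰⇒> c≰i , ≰⇒> j≰c , subst (j <_) (sym (+-assoc a (leaves l) (leaves r))) j<b)
          (proj₂ (nc (right (whole refl))))
...   | inj₂ refl | inj₂ refl = whole refl

-- If the apexes differed, the left chord of the tree with the later apex would cross the right
-- chord of the other.
tree-unique : ∀ t t′ {a} → leaves t ≡ leaves t′ →
  (∀ {i j p q} → Arc t a i j → Arc t′ a p q → ¬ (i < p × p < j × j < q) × ¬ (p < i × i < q × q < j)) → t ≡ t′
tree-unique leaf leaf _ _ = refl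
tree-unique leaf (node l r) e _ = contradiction (<-≤-trans (leavesˡ< l r) (subst (_≤ leaves l) e (0<leaves l))) 1+n≰n
tree-unique (node l r) leaf e _ = contradiction (<-≤-trans (leavesˡ< l r) (subst (_≤ leaves l) (sym e) (0<leaves l))) 1+n≰n
tree-unique (node l r) (node l′ r′) {a} e nc = cong₂ node
  (tree-unique l l′ l≡ (λ A B → nc (left A) (left B)))
  (tree-unique r r′ (+-cancelˡ-≡ (leaves l) _ _ (trans e (cong (_+ leaves r′) (sym l≡))))
    (λ A B → nc (right A) (right (subst (λ z → Arc r′ (a + z) _ _) l≡ B))))
  where
  l≡ : leaves l ≡ leaves l′
  l≡ with <-cmp (leaves l) (leaves l′)
  ... | tri≈ _ eq _ = eq
  ... | tri< lt _ _ = contradiction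
        (m<m+n a (0<leaves l) , +-monoʳ-< a lt ,
          subst (a + leaves l′ <_) (trans (cong (a +_) (sym e)) (sym (+-assoc a (leaves l) (leaves r)))) (+-monoʳ-< a (leavesˡ< l′ r′)))
        (proj₂ (nc (right (whole refl)) (left (whole refl))))
  ... | tri> _ _ gt = contradiction
        (m<m+n a (0<leaves l′) , +-monoʳ-< a gt ,
          subst (a + leaves l <_) (trans (cong (a +_) e) (sym (+-assoc a (leaves l′) (leaves r′)))) (+-monoʳ-< a (leavesˡ< l r)))
        (proj₁ (nc (left (whole refl)) (right (whole refl))))

leaves-comb≥ : ∀ t ws → leaves t ≤ leaves (comb t ws)
leaves-comb≥ t [] = ≤-refl
leaves-comb≥ t (w ∷ ws) = ≤-trans (leaves-comb≥ t ws) (<⇒≤ (leavesˡ< (comb t ws) w))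

leaves-comb> : ∀ t w ws → leaves t < leaves (comb t (w ∷ ws))
leaves-comb> t w ws = ≤-<-trans (leaves-comb≥ t ws) (leavesˡ< (comb t ws) w)

arc-comb : ∀ {t i j} ws → Arc t 0 i j → Arc (comb t ws) 0 i j
arc-comb [] A = A
arc-comb (w ∷ ws) A = left (arc-comb ws A)

¬arc-right : ∀ {l r : Tree} {x} → ¬ Arc r (leaves l) 0 x
¬arc-right {l} A = <⇒≱ (0<leaves l) (proj₁ (arc-bounds A))

arc-uncomb : ∀ {t x} ws → Arc (comb t ws) 0 0 x → x ≤ leaves t → Arc t 0 0 x
arc-uncomb [] A _ = A
arc-uncomb {t} (w ∷ ws) (whole refl) le = contradiction le (<⇒≱ (leaves-comb> t w ws))
arc-uncomb (w ∷ ws) (left A) le = arc-uncomb ws A le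
arc-uncomb {t} (w ∷ ws) (right A) le = contradiction A (¬arc-right {comb t ws})

-- Chords in a right subtree never reach vertex 0, so the chord to `x` is a node of the left spine
-- and the tree can be cut there.
comb-split : ∀ t {x} → Arc t 0 0 x → ∃ λ u → ∃ λ ws → t ≡ comb u ws × leaves u ≡ x
comb-split t (whole refl) = t , [] , refl , refl
comb-split (node l r) (left A) with comb-split l A
... | u , ws , refl , e = u , r ∷ ws , refl , e
comb-split (node l r) (right A) = contradiction A (¬arc-right {l})

-- A tree can be cut at any node of its left spine; the number of leaves below the cut fixes which
-- one.
comb-injective : ∀ {t t′} ws ws′ → leaves t ≡ leaves t′ → comb t ws ≡ comb t′ ws′ → t ≡ t′ × ws ≡ ws′
comb-injective [] [] _ eq = eq , refl
comb-injective {t} {t′} [] (w ∷ ws) e refl = contradiction (sym e) (<⇒≢ (leaves-comb> t′ w ws))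
comb-injective {t} {t′} (w ∷ ws) [] e refl = contradiction e (<⇒≢ (leaves-comb> t w ws))
comb-injective {t} {t′} (w ∷ ws) (w′ ∷ ws′) e eq with node-injective eq
  where
  node-injective : ∀ {l r l′ r′} → node l r ≡ node l′ r′ → l ≡ l′ × r ≡ r′
  node-injective refl = refl , refl
... | eq′ , refl with comb-injective ws ws′ e eq′
...   | eq″ , refl = eq″ , refl

-- The far ends of the chords at 0 from `comb t ws` down to `t`: together with 0, the corners of the
-- polygon.
spinePoints : Tree → List Tree → List ℕ
spinePoints t [] = leaves t ∷ []
spinePoints t (w ∷ ws) = leaves (comb t (w ∷ ws)) ∷ spinePoints t ws

length-spinePoints : ∀ t ws → length (spinePoints t ws) ≡ suc (length ws)
length-spinePoints t [] = refl
length-spinePoints t (w ∷ ws) = cong suc (length-spinePoints t ws)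

∈-spinePoints⁻ : ∀ t ws {x} → x List.∈ spinePoints t ws → leaves t ≤ x × x ≤ leaves (comb t ws) × Arc (comb t ws) 0 0 x
∈-spinePoints⁻ t [] (here refl) = ≤-refl , ≤-refl , whole refl
∈-spinePoints⁻ t (w ∷ ws) (here refl) = leaves-comb≥ t (w ∷ ws) , ≤-refl , whole refl
∈-spinePoints⁻ t (w ∷ ws) (there p) with ∈-spinePoints⁻ t ws p
... | lo , hi , A = lo , ≤-trans hi (<⇒≤ (leavesˡ< (comb t ws) w)) , left A

∈-spinePoints⁺ : ∀ t ws {x} → Arc (comb t ws) 0 0 x → leaves t ≤ x → x List.∈ spinePoints t ws
∈-spinePoints⁺ t [] A lo = here (≤-antisym (proj₂ (proj₂ (arc-bounds A))) lo)
∈-spinePoints⁺ t (w ∷ ws) (whole refl) lo = here refl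
∈-spinePoints⁺ t (w ∷ ws) (left A) lo = there (∈-spinePoints⁺ t ws A lo)
∈-spinePoints⁺ t (w ∷ ws) (right A) lo = contradiction A (¬arc-right {comb t ws})

spinePoints-unique : ∀ t ws → Unique (spinePoints t ws)
spinePoints-unique t [] = [] ∷ []
spinePoints-unique t (w ∷ ws) =
  All.tabulate (λ x∈ e → <⇒≱ (leavesˡ< (comb t ws) w) (subst (_≤ _) (sym e) (proj₁ (proj₂ (∈-spinePoints⁻ t ws x∈)))))
  ∷ spinePoints-unique t ws

T-ext : ∀ {a b} → (T a → T b) → (T b → T a) → a ≡ b
T-ext {true} {true} _ _ = refl
T-ext {false} {false} _ _ = refl
T-ext {true} {false} f _ = contradiction (f _) λ ()
T-ext {false} {true} _ g = contradiction (g _) λ ()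

-- A common interface for the arcs of a tree and for the chords recovered from a dissection, so that
-- one construction serves both. The sides of the polygon count as chords; `apexes` gives the
-- triangle under each longer one.
record Triangulation {M : ℕ} (A : Fin (suc M) → Fin (suc M) → Set) : Set where
  field
    chord?      : ∀ i j → Dec (A i j)
    ordered     : ∀ {i j} → A i j → i ≺ j
    sides       : ∀ {i j} → toℕ j ≡ suc (toℕ i) → A i j
    longSide    : ∀ {i j} → i ≺ j → toℕ i ≡ 0 → toℕ j ≡ M → A i j
    noncrossing : ∀ {a b c d} → A a b → A c d → ¬ Cross a b c d
    apexes      : ∀ {i j} → A i j → toℕ j ≡ suc (toℕ i) ⊎ ∃ λ c → i ≺ c × c ≺ j × A i c × A c j

-- The marked dissection obtained from a triangulation by deleting the chords from vertex 0 to the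
-- vertices strictly between p and b: the triangles around them merge into the polygon.
module Build {M : ℕ} {A : Fin (suc M) → Fin (suc M) → Set} (tri : Triangulation A)
  {p b : Fin (suc M)} (zp : A zero p) (zb : A zero b) (p<b : p ≺ b) where

  open Triangulation tri

  private
    z : Fin (suc M)
    z = zero

  Cut : Fin (suc M) → Fin (suc M) → Set
  Cut i j = i ≡ zero × p ≺ j × j ≺ b

  Kept : Fin (suc M) → Fin (suc M) → Set
  Kept i j = A i j × ¬ Side i j × ¬ Cut i j

  kept? : ∀ i j → Dec (Kept i j)
  kept? i j = chord? i j ×-dec (¬? (side? i j) ×-dec
    ¬? ((i Fin.≟ zero) ×-dec ((toℕ p <? toℕ j) ×-dec (toℕ j <? toℕ b))))

  Diag : Fin (suc M) → Fin (suc M) → Set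
  Diag i j = Kept i j ⊎ Kept j i

  diag? : ∀ i j → Dec (Diag i j)
  diag? i j = kept? i j ⊎-dec kept? j i

  diag-sym : ∀ {i j} → Diag i j → Diag j i
  diag-sym = [ inj₂ , inj₁ ]′

  diag-≺ : ∀ {i j} → i ≺ j → Diag i j → Kept i j
  diag-≺ _ (inj₁ k) = k
  diag-≺ i<j (inj₂ (ji , _)) = contradiction (ordered ji) (<-asym i<j)

  dissection : Dissection (suc M)
  dissection = record
    { D = λ i j → ⌊ diag? i j ⌋
    ; D-sym = λ i j → T-ext (fromWitness {a? = diag? j i} ∘ diag-sym ∘ toWitness {a? = diag? i j})
                           (fromWitness {a? = diag? i j} ∘ diag-sym ∘ toWitness {a? = diag? j i})
    ; D-diag = λ i j d → diagonal (toWitness {a? = diag? i j} d)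
    ; D-noncr = λ a b c d ab cd (a<c , c<b , b<d) → noncrossing
        (proj₁ (diag-≺ (<-trans a<c c<b) (toWitness {a? = diag? a b} ab)))
        (proj₁ (diag-≺ (<-trans c<b b<d) (toWitness {a? = diag? c d} cd))) (a<c , c<b , b<d) }
    where
    diagonal : ∀ {i j} → Diag i j → Diagonal i j
    diagonal (inj₁ (ij , ¬s , _)) = <⇒≢ (ordered ij) , ¬s
    diagonal (inj₂ (ji , ¬s , _)) = (<⇒≢ (ordered ji) ∘ sym) , ¬s ∘ side-sym

  z<p : z ≺ p
  z<p = ordered zp

  z<b : z ≺ b
  z<b = ordered zb

  edge⇒chord : ∀ {i j} → i ≺ j → Edge dissection i j → A i j × ¬ Cut i j
  edge⇒chord {i} {j} i<j (inj₂ d) with diag-≺ i<j (toWitness {a? = diag? i j} d)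
  ... | ij , _ , ¬cut = ij , ¬cut
  edge⇒chord i<j (inj₁ s) with side-≺ s i<j
  ... | inj₁ e = sides e , λ { (refl , p<j , _) → <⇒≱ z<p (≤-pred (subst (toℕ p <_) e p<j)) }
  ... | inj₂ (i≡0 , j≡M) = longSide i<j i≡0 (suc-injective j≡M) ,
          λ (_ , _ , j<b) → <⇒≱ (Fin.toℕ<n b) (subst (_≤ toℕ b) j≡M j<b)

  chord⇒edge : ∀ {i j} → A i j → ¬ Cut i j → Edge dissection i j
  chord⇒edge {i} {j} ij ¬cut = bySide (side? i j)
    where
    bySide : Dec (Side i j) → Edge dissection i j
    bySide (yes s) = inj₁ s
    bySide (no ¬s) = inj₂ (fromWitness {a? = diag? i j} (inj₁ (ij , ¬s , ¬cut)))

  ¬cut≢0 : ∀ {i j k} → k ≺ i → ¬ Cut i j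
  ¬cut≢0 k<i (refl , _) = n≮0 k<i

  Corner : Fin (suc M) → Set
  Corner x = x ≡ zero ⊎ (p ≼ x × x ≼ b × A zero x)

  corner? : ∀ x → Dec (Corner x)
  corner? x = (x Fin.≟ zero) ⊎-dec ((toℕ p ≤? toℕ x) ×-dec ((toℕ x ≤? toℕ b) ×-dec chord? zero x))

  R : Subset (suc M)
  R = subset corner?

  z∈R : zero ∈ R
  z∈R = ∈-subset⁺ corner? (inj₁ refl)

  ∈R : ∀ {x} → p ≼ x → x ≼ b → A zero x → x ∈ R
  ∈R lo hi zx = ∈-subset⁺ corner? (inj₂ (lo , hi , zx))

  p∈R : p ∈ R
  p∈R = ∈R ≤-refl (<⇒≤ p<b) zp

  b∈R : b ∈ R
  b∈R = ∈R (<⇒≤ p<b) ≤-refl zb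

  ∈R⁻ : ∀ {x} → x ∈ R → z ≺ x → p ≼ x × x ≼ b × A zero x
  ∈R⁻ x∈ z<x with ∈-subset⁻ corner? x∈
  ... | inj₁ refl = contradiction z<x (<-irrefl refl)
  ... | inj₂ c = c

  R≼b : ∀ c → c ∈ R → z ≼ c × c ≼ b
  R≼b c c∈ with ∈-subset⁻ corner? c∈
  ... | inj₁ refl = z≤n , z≤n
  ... | inj₂ (_ , c≤b , _) = z≤n , c≤b

  R-span : Span R zero b
  R-span = z∈R , b∈R , R≼b

  private
    zero-or-pos : ∀ x → x ≡ zero ⊎ z ≺ x
    zero-or-pos zero = inj₁ refl
    zero-or-pos (suc x) = inj₂ (s≤s z≤n)

  R-face : Face dissection R
  R-face = unique⇒length≤∣∣ {xs = zero ∷ p ∷ b ∷ []}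
      ((≺-irrefl z<p ∷ ≺-irrefl z<b ∷ []) ∷ (≺-irrefl p<b ∷ []) ∷ [] ∷ []) (z∈R ∷ p∈R ∷ b∈R ∷ []) ,
    edges , uncut
    where
    edges : ∀ x y → ConsecIn R x y → Edge dissection x y
    edges x y (x∈ , y∈ , x<y , inj₂ all)
      with Fin.toℕ-injective {j = z} (n≤0⇒n≡0 (proj₁ (all zero z∈R)))
         | Fin.toℕ-injective (≤-antisym (proj₂ (R≼b y y∈)) (proj₂ (all b b∈R)))
    ... | refl | refl = chord⇒edge zb λ (_ , _ , b<b) → <-irrefl refl b<b
    edges x y (x∈ , y∈ , x<y , inj₁ none) with zero-or-pos x | ∈R⁻ y∈ (≤-<-trans z≤n x<y)
    ... | inj₁ refl | p≤y , _ , zy = chord⇒edge zy λ (_ , p<y , _) → none p p∈R (z<p , p<y)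
    -- The apex `c` of the triangle under the chord from 0 to `y` must be `x`: if smaller, `cy`
    -- would cross the chord from 0 to `x`; if larger, it would be a corner in the gap.
    ... | inj₂ z<x | p≤y , y≤b , zy with apexes zy
    ...   | inj₁ e = contradiction z<x (<⇒≱ (subst (toℕ x <_) e x<y))
    ...   | inj₂ (c , z<c , c<y , zc , cy) with <-cmp (toℕ c) (toℕ x) | ∈R⁻ x∈ z<x
    ...     | tri≈ _ e _ | _ with Fin.toℕ-injective e
    ...       | refl = chord⇒edge cy (¬cut≢0 {k = zero} z<x)
    edges x y (x∈ , y∈ , x<y , inj₁ none) | inj₂ z<x | p≤y , y≤b , zy | inj₂ (c , z<c , c<y , zc , cy)
            | tri< c<x _ _ | _ , _ , zx = contradiction (z<c , c<x , x<y) (noncrossing zx cy)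
    edges x y (x∈ , y∈ , x<y , inj₁ none) | inj₂ z<x | p≤y , y≤b , zy | inj₂ (c , z<c , c<y , zc , cy)
            | tri> _ _ x<c | p≤x , _ , _ = contradiction (x<c , c<y)
              (none c (∈R (≤-trans p≤x (<⇒≤ x<c)) (≤-trans (<⇒≤ c<y) y≤b) zc))
    uncut : ∀ x y → x ∈ R → y ∈ R → x ≺ y → T (D dissection x y) → ConsecIn R x y
    uncut x y x∈ y∈ x<y d with edge⇒chord x<y (inj₂ d) | zero-or-pos x | ∈R⁻ y∈ (≤-<-trans z≤n x<y)
    ... | xy , _ | inj₂ z<x | _ , y≤b , zy = x∈ , y∈ , x<y , inj₁ λ c c∈ (x<c , c<y) →
            noncrossing (proj₂ (proj₂ (∈R⁻ c∈ (<-trans z<x x<c)))) xy (z<x , x<c , c<y)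
    ... | xy , ¬cut | inj₁ refl | p≤y , y≤b , _ with m≤n⇒m<n∨m≡n p≤y | m≤n⇒m<n∨m≡n y≤b
    ...   | inj₁ p<y | inj₁ y<b = contradiction (refl , p<y , y<b) ¬cut
    ...   | inj₂ p≡y | _ = x∈ , y∈ , x<y , inj₁ λ c c∈ (z<c , c<y) →
              <⇒≱ c<y (subst (_≤ toℕ c) p≡y (proj₁ (∈R⁻ c∈ z<c)))
    ...   | inj₁ _ | inj₂ y≡b = x∈ , y∈ , x<y , inj₂ λ c c∈ → z≤n , subst (toℕ c ≤_) (sym y≡b) (proj₂ (R≼b c c∈))

  -- A face whose closing side joins 0 and `b` is `R`. Under any other closing side the triangle of
  -- the triangulation has survived, and `face-unique` identifies the face with it.
  R-others : ∀ S → Face dissection S → ∣ S ∣ ≡ 3 ⊎ S ≡ R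
  R-others S S-face@(3≤ , edges , _) with span (proj₂ (inhabited 3≤))
  ... | i , j , sp@(i∈ , j∈ , all) with between 3≤ sp
  ...   | e , _ , i<e , e<j = byEnds (i Fin.≟ zero) (j Fin.≟ b)
    where
    i<j = <-trans i<e e<j
    ij : Edge dissection i j
    ij = edges i j (i∈ , j∈ , i<j , inj₂ all)
    ear : ¬ (i ≡ zero × j ≡ b) → ∣ S ∣ ≡ 3
    ear ¬zb with edge⇒chord i<j ij
    ... | A-ij , ¬cut with apexes A-ij
    ...   | inj₁ eq = contradiction i<e (<⇒≱ (subst (toℕ e <_) eq e<j))
    ...   | inj₂ (c , i<c , c<j , ic , cj) = trans
              (cong ∣_∣ (face-unique dissection S-face
                (triangle-face i<c c<j dissection (chord⇒edge ic ¬cut-ic) (chord⇒edge cj (¬cut≢0 i<c)) ij)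
                sp (triangle-span i<c c<j)))
              (triangle-size i<c c<j)
      where
      -- Were the chord to `c` deleted, then `j` before `b` would make `ij` deleted too, `j` equal
      -- to `b` is the excluded case, and for `j` beyond `b` the chord `cj` would cross the marked
      -- edge.
      ¬cut-ic : ¬ Cut i c
      ¬cut-ic (refl , p<c , c<b) with <-cmp (toℕ j) (toℕ b)
      ... | tri< j<b _ _ = ¬cut (refl , <-trans p<c c<j , j<b)
      ... | tri≈ _ j≡b _ = ¬zb (refl , Fin.toℕ-injective j≡b)
      ... | tri> _ _ b<j = noncrossing zb cj (i<c , c<b , b<j)
    byEnds : Dec (i ≡ zero) → Dec (j ≡ b) → ∣ S ∣ ≡ 3 ⊎ S ≡ R
    byEnds (yes refl) (yes refl) = inj₂ (face-unique dissection S-face R-face sp R-span)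
    byEnds (no i≢0) _ = inj₁ (ear (i≢0 ∘ proj₁))
    byEnds _ (no j≢b) = inj₁ (ear (j≢b ∘ proj₂))

  marked : ∀ {r} → ∣ R ∣ ≡ r → MarkedDiss r (suc M)
  marked size = record
    { diss = dissection ; rgon = R ; rgon-face = R-face ; rgon-size = size ; others = R-others
    ; e₁ = zero ; e₂ = b ; edge = z∈R , b∈R , z<b , inj₂ R≼b }

toFin : ∀ {M x} → x ≤ M → ∃ λ (i : Fin (suc M)) → toℕ i ≡ x
toFin x≤M = fromℕ< (s≤s x≤M) , Fin.toℕ-fromℕ< (s≤s x≤M)

module _ {M : ℕ} where

  TreeChord : Tree → Fin (suc M) → Fin (suc M) → Set
  TreeChord t i j = Arc t 0 (toℕ i) (toℕ j)

  tree-triangulation : ∀ t → leaves t ≡ M → Triangulation (TreeChord t)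
  tree-triangulation t refl = record
    { chord? = λ i j → arc? t 0 (toℕ i) (toℕ j)
    ; ordered = λ a → proj₁ (proj₂ (arc-bounds a))
    ; sides = λ {i} {j} e → subst (Arc t 0 (toℕ i)) (sym e)
        (arc-side t z≤n (≤-pred (subst (_< suc M) e (Fin.toℕ<n j))))
    ; longSide = λ _ i≡0 j≡M → subst₂ (Arc t 0) (sym i≡0) (sym j≡M) (whole refl)
    ; noncrossing = arc-noncrossing
    ; apexes = λ a → apexes (arc-apex a) }
    where
    apexes : ∀ {i j : Fin (suc M)} →
      toℕ j ≡ suc (toℕ i) ⊎ (∃ λ c → toℕ i < c × c < toℕ j × Arc t 0 (toℕ i) c × Arc t 0 c (toℕ j)) →
      toℕ j ≡ suc (toℕ i) ⊎ (∃ λ c → i ≺ c × c ≺ j × TreeChord t i c × TreeChord t c j)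
    apexes (inj₁ e) = inj₁ e
    apexes {j = j} (inj₂ (c , i<c , c<j , ic , cj)) with toFin (≤-pred (<-trans c<j (Fin.toℕ<n j)))
    ... | c′ , refl = inj₂ (c′ , i<c , c<j , ic , cj)

  module _ {A : Fin (suc M) → Fin (suc M) → Set} (tri : Triangulation A) where

    open Triangulation tri

    private
      -- The start `a` is tied to `i` by an equation because the right subtree begins at
      -- `toℕ i + leaves l`, which equals the apex only propositionally.
      ArcsIn : Tree → Fin (suc M) → Set
      ArcsIn t i = ∀ {a x y} → a ≡ toℕ i → Arc t a x y → ∀ u v → toℕ u ≡ x → toℕ v ≡ y → A u v

      grow : ∀ f i j → toℕ j ≤ toℕ i + f → A i j → ∃ λ t → toℕ i + leaves t ≡ toℕ j × ArcsIn t i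
      grow zero i j le ij = contradiction (subst (toℕ j ≤_) (+-identityʳ _) le) (<⇒≱ (ordered ij))
      grow (suc f) i j le ij with apexes ij
      ... | inj₁ e = leaf , trans (+-comm _ 1) (sym e) , λ { refl (whole refl) u v p q →
              subst₂ A (sym (Fin.toℕ-injective p)) (Fin.toℕ-injective (trans e (trans (+-comm 1 _) (sym q)))) ij }
      ... | inj₂ (c , i<c , c<j , ic , cj)
        with grow f i c (≤-pred (≤-trans c<j (≤-trans le (≤-reflexive (+-suc _ f))))) ic
           | grow f c j (≤-trans le (≤-trans (≤-reflexive (+-suc _ f)) (+-monoˡ-≤ f i<c))) cj
      ...   | l , l-width , l-in | r , r-width , r-in = node l r , width , λ
              { refl (whole refl) u v p q → subst₂ A (sym (Fin.toℕ-injective p))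
                  (Fin.toℕ-injective (trans (sym width) (sym q))) ij
              ; refl (left B) → l-in refl B
              ; refl (right B) → r-in l-width B }
        where
        width : toℕ i + (leaves l + leaves r) ≡ toℕ j
        width = trans (sym (+-assoc (toℕ i) _ _)) (trans (cong (_+ leaves r) l-width) r-width)

    -- Splitting at apexes yields a tree all of whose arcs are chords. Conversely a chord crosses
    -- none of these arcs, so `arc-maximal` makes it one of them.
    triangulation-tree : 0 < M → ∃ λ t → leaves t ≡ M ×
      (∀ {u v} → TreeChord t u v → A u v) × (∀ {u v} → A u v → TreeChord t u v)
    triangulation-tree 0<M with toFin {M} ≤-refl
    ... | last , last≡M with grow M zero last (≤-reflexive last≡M)
                             (longSide (subst (0 <_) (sym last≡M) 0<M) refl last≡M)
    ...   | t , width , arcs = t , trans width last≡M , (λ {u} {v} B → arcs refl B u v refl refl) , λ {u} {v} uv →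
              arc-maximal t z≤n (ordered uv)
                (subst (toℕ v ≤_) (sym (trans width last≡M)) (≤-pred (Fin.toℕ<n v))) (noncross uv)
      where
      noncross : ∀ {u v p q} → A u v → Arc t 0 p q →
        ¬ (p < toℕ u × toℕ u < q × q < toℕ v) × ¬ (toℕ u < p × p < toℕ v × toℕ v < q)
      noncross uv B with arc-bounds B
      ... | _ , p<q , q≤ with ≤-trans q≤ (≤-reflexive (trans width last≡M))
      ...   | q≤M with toFin (≤-trans (<⇒≤ p<q) q≤M) | toFin q≤M
      ...     | p′ , refl | q′ , refl = noncrossing (arcs refl B p′ q′ refl refl) uv ,
                noncrossing uv (arcs refl B p′ q′ refl refl)

-- Recovering a triangulation from a canonical marked dissection

module FromCanonical {r M : ℕ} (X : MarkedDiss r (suc M)) (can : Canonical X) where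

  private
    Δ = diss X
    z : Fin (suc M)
    z = zero

  b : Fin (suc M)
  b = e₂ X

  R : Subset (suc M)
  R = rgon X

  e₁≡0 : e₁ X ≡ zero
  e₁≡0 = Fin.toℕ-injective (proj₁ can)

  zb-consec : ConsecIn R zero b
  zb-consec = subst (λ e → ConsecIn R e b) e₁≡0 (edge X)

  zb : Edge Δ zero b
  zb = proj₁ (proj₂ (rgon-face X)) zero b zb-consec

  z∈R : zero ∈ R
  z∈R = proj₁ zb-consec

  b∈R : b ∈ R
  b∈R = proj₁ (proj₂ zb-consec)

  z<b : z ≺ b
  z<b = proj₁ (proj₂ (proj₂ zb-consec))

  R-span : Span R zero b
  R-span = z∈R , b∈R , λ c c∈ → z≤n , proj₂ can c c∈

  abstract
    firstCorner : ∃ λ p → (p ∈ R × z ≺ p) × p ≼ b × (∀ w → w ∈ R × z ≺ w → p ≼ w)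
    firstCorner = least (λ x → (x ∈? R) ×-dec (toℕ z <? toℕ x)) (b∈R , z<b)

  p : Fin (suc M)
  p = proj₁ firstCorner

  p∈R : p ∈ R
  p∈R = proj₁ (proj₁ (proj₂ firstCorner))

  z<p : z ≺ p
  z<p = proj₂ (proj₁ (proj₂ firstCorner))

  p-least : ∀ {x} → x ∈ R → z ≺ x → p ≼ x
  p-least x∈ z<x = proj₂ (proj₂ (proj₂ firstCorner)) _ (x∈ , z<x)

  p<b : p ≺ b
  p<b with between (proj₁ (rgon-face X)) R-span
  ... | x , x∈ , z<x , x<b = ≤-<-trans (p-least x∈ z<x) x<b

  zp : Edge Δ zero p
  zp = proj₁ (proj₂ (rgon-face X)) zero p
    (z∈R , p∈R , z<p , inj₁ λ c c∈ (z<c , c<p) → <⇒≱ c<p (p-least c∈ z<c))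

  -- This keeps the added chord from 0 to `y` free of crossings. An edge over `y` that ends by `b`
  -- would have to start at 0 by `chord-around`; one that ends later crosses the marked edge.
  corner-uncovered : ∀ {c d y} → y ∈ R → z ≺ c → c ≺ y → y ≺ d → ¬ Edge Δ c d
  corner-uncovered {c} {d} {y} y∈ z<c c<y y<d cd with toℕ d ≤? toℕ b
  ... | yes d≤b = contradiction (proj₁ (chord-around Δ (rgon-face X) R-span z≤n d≤b y∈ c<y y<d Dcd)) (<⇒≱ z<c)
    where Dcd = edge⇒D Δ cd c<y y<d λ (c≡0 , _) → n≮0 (subst (0 <_) c≡0 z<c)
  ... | no d≰b = contradiction (z<c , c<b , ≰⇒> d≰b) (D-noncr Δ zero b c d
          (edge⇒D Δ zb z<c c<b λ (_ , b≡M) → <⇒≱ (Fin.toℕ<n d) (subst (_≤ toℕ d) b≡M (≰⇒> d≰b)))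
          (edge⇒D Δ cd c<y y<d λ (c≡0 , _) → n≮0 (subst (0 <_) c≡0 z<c)))
    where c<b = <-≤-trans c<y (proj₂ can y y∈)

  -- The edges of the dissection, with the polygon triangulated as a fan from vertex 0.
  A : Fin (suc M) → Fin (suc M) → Set
  A i j = i ≺ j × (Edge Δ i j ⊎ (i ≡ zero × j ∈ R))

  private
    noncross : ∀ {i j c d} → A i j → A c d → ¬ Cross i j c d
    noncross {i} {j} {c} {d} (_ , inj₁ ij) (_ , inj₁ cd) (i<c , c<j , j<d) = D-noncr Δ _ _ _ _
      (edge⇒D Δ ij i<c c<j λ (_ , j≡M) → <⇒≱ (Fin.toℕ<n d) (subst (_≤ toℕ d) j≡M j<d))
      (edge⇒D Δ cd c<j j<d λ (c≡0 , _) → n≮0 (subst (toℕ i <_) c≡0 i<c)) (i<c , c<j , j<d)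
    noncross (_ , inj₂ (refl , j∈)) (_ , inj₁ cd) (i<c , c<j , j<d) = corner-uncovered j∈ i<c c<j j<d cd
    noncross _ (_ , inj₂ (refl , _)) (i<c , _) = n≮0 i<c

    Apex : Fin (suc M) → Fin (suc M) → Set
    Apex i j = toℕ j ≡ suc (toℕ i) ⊎ ∃ λ c → i ≺ c × c ≺ j × A i c × A c j

    corner-apex : ∀ {j} → j ∈ R → p ≺ j → Apex zero j
    corner-apex {j} j∈ p<j with greatest (λ x → (x ∈? R) ×-dec (toℕ x <? toℕ j)) (p∈R , p<j)
    ... | c , (c∈ , c<j) , p≤c , top = inj₂ (c , z<c , c<j , (z<c , inj₂ (refl , c∈)) ,
            (c<j , inj₁ (proj₁ (proj₂ (rgon-face X)) c j
              (c∈ , j∈ , c<j , inj₁ λ x x∈ (c<x , x<j) → <⇒≱ c<x (top x (x∈ , x<j))))))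
      where z<c = <-≤-trans z<p p≤c

    -- The face under the edge is a triangle, which provides the apex, or it is the polygon. In the
    -- latter case the edge starts at 0 and the fan triangle under it is used.
    edge-apex : ∀ {i j} → i ≺ j → Edge Δ i j → Apex i j
    edge-apex {i} {j} i<j ij with m≤n⇒m<n∨m≡n i<j
    ... | inj₂ e = inj₁ (sym e)
    ... | inj₁ i+1<j with edge-face Δ ij i+1<j
    ...   | S , S-face , S-span@(i∈ , j∈ , all) with others X S S-face
    ...     | inj₁ size with apex {Δ = Δ} S-face S-span size
    ...       | c , i<c , c<j , ic , cj = inj₂ (c , i<c , c<j , (i<c , inj₁ ic) , (c<j , inj₁ cj))
    edge-apex {i} {j} i<j ij | inj₁ _ | S , S-face , (i∈ , j∈ , all) | inj₂ refl
      with Fin.toℕ-injective {i = i} {j = z} (n≤0⇒n≡0 (proj₁ (all zero z∈R)))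
    ... | refl = corner-apex j∈ (<-≤-trans p<b (proj₂ (all b b∈R)))

    apex-of : ∀ {i j} → A i j → Apex i j
    apex-of (i<j , inj₁ ij) = edge-apex i<j ij
    apex-of (i<j , inj₂ (refl , j∈)) with m≤n⇒m<n∨m≡n (p-least j∈ i<j)
    ... | inj₁ p<j = corner-apex j∈ p<j
    ... | inj₂ p≡j with Fin.toℕ-injective p≡j
    ...   | refl = edge-apex i<j zp

  triangulation : Triangulation A
  triangulation = record
    { chord? = λ i j → (toℕ i <? toℕ j) ×-dec (edge? Δ i j ⊎-dec ((i Fin.≟ zero) ×-dec (j ∈? R)))
    ; ordered = proj₁
    ; sides = λ {i} {j} → next {i} {j}
    ; longSide = λ {i} {j} → long {i} {j}
    ; noncrossing = noncross
    ; apexes = apex-of }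
    where
    next : ∀ {i j} → toℕ j ≡ suc (toℕ i) → A i j
    next e = ≤-reflexive (sym e) , inj₁ (inj₁ (inj₁ e))
    long : ∀ {i j} → i ≺ j → toℕ i ≡ 0 → toℕ j ≡ M → A i j
    long i<j i≡0 j≡M = i<j , inj₁ (inj₁ (inj₂ (inj₂ (inj₁ (i≡0 , cong suc j≡M)))))

  chord-zp : A zero p
  chord-zp = z<p , inj₁ zp

  chord-zb : A zero b
  chord-zb = z<b , inj₁ zb

  -- Otherwise `x` lies under a side of the polygon that avoids 0, and the chord from 0 to `x`
  -- crosses that side. Hence the chords that `Build` deletes are exactly those the fan added.
  fan⇒corner : ∀ {x} → p ≼ x → x ≼ b → A zero x → x ∈ R
  fan⇒corner p≤x x≤b (_ , inj₂ (_ , x∈)) = x∈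
  fan⇒corner {x} p≤x x≤b (z<x , inj₁ zx) with x ∈? R
  ... | yes x∈ = x∈
  ... | no x∉ with neighbours x∉ p∈R (≼∧∉∈⇒≺ p≤x p∈R x∉) b∈R (≼∧∈∉⇒≺ x≤b x∉ b∈R)
  ...   | u , v , u∈ , v∈ , p≤u , u<x , x<v , _ , gap = contradiction (z<u , u<x , x<v)
          (noncross {i = zero} (z<x , inj₁ zx) (u<v , inj₁ (proj₁ (proj₂ (rgon-face X)) u v (u∈ , v∈ , u<v , inj₁ gap))))
    where
    z<u = <-≤-trans z<p p≤u
    u<v = <-trans u<x x<v

  open Build triangulation chord-zp chord-zb p<b using (Corner; Kept; Diag)

  corner⇒∈R : ∀ {x} → Corner x → x ∈ R
  corner⇒∈R (inj₁ refl) = z∈R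
  corner⇒∈R (inj₂ (lo , hi , zx)) = fan⇒corner lo hi zx

  ∈R⇒corner : ∀ {x} → x ∈ R → Corner x
  ∈R⇒corner {zero} _ = inj₁ refl
  ∈R⇒corner {suc x} x∈ = inj₂ (p-least x∈ (s≤s z≤n) , proj₂ can _ x∈ , s≤s z≤n , inj₂ (refl , x∈))

  D⇒kept : ∀ {i j} → i ≺ j → T (D Δ i j) → Kept i j
  D⇒kept {i} {j} i<j d = ij , proj₂ (D-diag Δ i j d) , ¬cut
    where
    ij : A i j
    ij = i<j , inj₁ (inj₂ d)
    ¬cut : ¬ (i ≡ zero × p ≺ j × j ≺ b)
    ¬cut (refl , p<j , j<b) with proj₂ (proj₂ (rgon-face X)) i j z∈R (fan⇒corner (<⇒≤ p<j) (<⇒≤ j<b) ij) i<j d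
    ... | _ , _ , _ , inj₁ none = none p p∈R (z<p , p<j)
    ... | _ , _ , _ , inj₂ all = <⇒≱ j<b (proj₂ (all b b∈R))

  kept⇒D : ∀ {i j} → Kept i j → T (D Δ i j)
  kept⇒D ((_ , inj₁ (inj₁ s)) , ¬s , _) = contradiction s ¬s
  kept⇒D ((_ , inj₁ (inj₂ d)) , _) = d
  kept⇒D {j = j} ((i<j , inj₂ (refl , j∈)) , ¬s , ¬cut)
    with m≤n⇒m<n∨m≡n (p-least j∈ i<j) | m≤n⇒m<n∨m≡n (proj₂ can j j∈)
  ... | inj₁ p<j | inj₁ j<b = contradiction (refl , p<j , j<b) ¬cut
  ... | inj₁ _ | inj₂ j≡b with Fin.toℕ-injective j≡b
  ...   | refl = [ (λ s → contradiction s ¬s) , (λ d → d) ]′ zb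
  kept⇒D {j = j} ((i<j , inj₂ (refl , j∈)) , ¬s , ¬cut) | inj₂ p≡j | _ with Fin.toℕ-injective p≡j
  ...   | refl = [ (λ s → contradiction s ¬s) , (λ d → d) ]′ zp

  diag⇒D : ∀ {i j} → Diag i j → T (D Δ i j)
  diag⇒D (inj₁ k) = kept⇒D k
  diag⇒D {i} {j} (inj₂ k) = subst T (D-sym Δ j i) (kept⇒D k)

  D⇒diag : ∀ {i j} → T (D Δ i j) → Diag i j
  D⇒diag {i} {j} d with <-cmp (toℕ i) (toℕ j)
  ... | tri< i<j _ _ = inj₁ (D⇒kept i<j d)
  ... | tri≈ _ e _ = contradiction e (proj₁ (D-diag Δ i j d))
  ... | tri> _ _ j<i = inj₂ (D⇒kept j<i (subst T (D-sym Δ i j) d))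

-- Arithmetic of iterated rotations

toℕ-rotBy : ∀ {M} t (i : Fin (suc M)) → toℕ (rotBy t i) ≡ (t + toℕ i) % suc M
toℕ-rotBy zero i = sym (m<n⇒m%n≡m (Fin.toℕ<n i))
toℕ-rotBy {M} (suc t) i = begin
  toℕ (rot (rotBy t i))                         ≡⟨ Fin.toℕ-fromℕ< (m%n<n (suc (toℕ (rotBy t i))) (suc M)) ⟩
  suc (toℕ (rotBy t i)) % suc M                 ≡⟨ cong (λ x → suc x % suc M) (toℕ-rotBy t i) ⟩
  suc (s % suc M) % suc M                       ≡⟨ %-distribˡ-+ 1 (s % suc M) (suc M) ⟩
  (1 % suc M + s % suc M % suc M) % suc M       ≡⟨ cong (λ x → (1 % suc M + x) % suc M) (m%n%n≡m%n s (suc M)) ⟩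
  (1 % suc M + s % suc M) % suc M               ≡⟨ %-distribˡ-+ 1 s (suc M) ⟨
  suc s % suc M                                 ∎
  where
  open ≡-Reasoning
  s = t + toℕ i

rotBy-shift : ∀ {M} t (i : Fin (suc M)) → toℕ (rotBy t i) ≡ (toℕ (rotBy {suc M} t zero) + toℕ i) % suc M
rotBy-shift {M} t i = begin
  toℕ (rotBy t i)                               ≡⟨ toℕ-rotBy t i ⟩
  (t + toℕ i) % suc M                           ≡⟨ %-distribˡ-+ t (toℕ i) (suc M) ⟩
  (t % suc M + toℕ i % suc M) % suc M           ≡⟨ cong (λ x → (x + toℕ i % suc M) % suc M) (m%n%n≡m%n t (suc M)) ⟨
  (t % suc M % suc M + toℕ i % suc M) % suc M   ≡⟨ %-distribˡ-+ (t % suc M) (toℕ i) (suc M) ⟨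
  (t % suc M + toℕ i) % suc M                   ≡⟨ cong (λ x → (x + toℕ i) % suc M) zero-image ⟨
  (toℕ (rotBy {suc M} t zero) + toℕ i) % suc M  ∎
  where
  open ≡-Reasoning
  zero-image : toℕ (rotBy {suc M} t zero) ≡ t % suc M
  zero-image = trans (toℕ-rotBy t zero) (cong (_% suc M) (+-identityʳ t))

rotBy-identity : ∀ {M} t → rotBy {suc M} t zero ≡ zero → ∀ i → rotBy {suc M} t i ≡ i
rotBy-identity {M} t e i = Fin.toℕ-injective (trans (rotBy-shift t i)
  (trans (cong (λ z → (toℕ z + toℕ i) % suc M) e) (m<n⇒m%n≡m (Fin.toℕ<n i))))

-- Here `b` is the first vertex to wrap around, so the vertices before it are only shifted up. This
-- rules out rotations that swap the ends of the marked edge.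
rotBy-beyond : ∀ {M} t (b : Fin (suc M)) → zero ≺ rotBy {suc M} t zero → rotBy t b ≡ zero →
  ∀ x → zero {M} ≺ x → x ≺ b → rotBy {suc M} t zero ≺ rotBy t x
rotBy-beyond {M} t b 0<s sb≡0 x 0<x x<b =
  subst (s <_) (sym (trans (rotBy-shift t x) (m<n⇒m%n≡m (<-≤-trans (+-monoʳ-< s x<b) s+b≤m)))) (m<m+n s 0<x)
  where
  s = toℕ (rotBy {suc M} t zero)
  s+b%m≡0 : (s + toℕ b) % suc M ≡ 0
  s+b%m≡0 = trans (sym (rotBy-shift t b)) (cong toℕ sb≡0)
  -- The sum is a multiple of `suc M` below twice `suc M`.
  s+b≤m : s + toℕ b ≤ suc M
  s+b≤m with suc M ≤? s + toℕ b
  ... | no ≰ = <⇒≤ (≰⇒> ≰)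
  ... | yes m≤ = m∸n≡0⇒m≤n (trans (sym (m<n⇒m%n≡m (+-cancelʳ-< (suc M) _ _
          (subst (_< suc M + suc M) (sym (m∸n+n≡m m≤)) (+-mono-< (Fin.toℕ<n (rotBy {suc M} t zero)) (Fin.toℕ<n b))))))
          (trans (m≤n⇒[n∸m]%m≡n%m m≤) s+b%m≡0))

face-cong : ∀ {m} {Δ Δ′ : Dissection m} {S} → (∀ i j → D Δ i j ≡ D Δ′ i j) → Face Δ S → Face Δ′ S
face-cong e (3≤ , edges , uncut) = 3≤ ,
  (λ a b ab → [ inj₁ , inj₂ ∘ subst T (e a b) ]′ (edges a b ab)) ,
  (λ a b a∈ b∈ a<b d → uncut a b a∈ b∈ a<b (subst T (sym (e a b)) d))

module _ {M : ℕ} (t : Tree) (ws us : List Tree) where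

  IsCorner : Fin (suc M) → Set
  IsCorner x = x ≡ zero ⊎ (leaves t ≤ toℕ x × toℕ x ≤ leaves (comb t ws) × TreeChord (comb (comb t ws) us) zero x)

  corner-count : leaves (comb (comb t ws) us) ≡ M → (S : Subset (suc M)) →
    (∀ {x} → x ∈ S → IsCorner x) → (∀ {x} → IsCorner x → x ∈ S) → ∣ S ∣ ≡ 2 + length ws
  corner-count width S sound complete = begin
    ∣ S ∣                          ≡⟨ length-elements S ⟨
    length (elements S)            ≡⟨ length-map toℕ (elements S) ⟨
    length (map toℕ (elements S))  ≡⟨ ≤-antisym
                                        (unique-⊆⇒length≤ (Unique.map⁺ Fin.toℕ-injective (elements-unique S)) sub)
                                        (unique-⊆⇒length≤ points-unique sup) ⟩
    suc (length (spinePoints t ws)) ≡⟨ cong suc (length-spinePoints t ws) ⟩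
    2 + length ws                  ∎
    where
    open ≡-Reasoning
    points-unique : Unique (0 ∷ spinePoints t ws)
    points-unique = All.tabulate (λ x∈ e → <⇒≱ (0<leaves t) (subst (leaves t ≤_) (sym e) (proj₁ (∈-spinePoints⁻ t ws x∈))))
      ∷ spinePoints-unique t ws
    sub : ∀ {x} → x List.∈ map toℕ (elements S) → x List.∈ 0 ∷ spinePoints t ws
    sub x∈ with ∈-map⁻ toℕ x∈
    ... | i , i∈ , refl with sound (∈-elements⁻ i∈)
    ...   | inj₁ refl = here refl
    ...   | inj₂ (lo , hi , A) = there (∈-spinePoints⁺ t ws (arc-uncomb us A hi) lo)
    sup : ∀ {x} → x List.∈ 0 ∷ spinePoints t ws → x List.∈ map toℕ (elements S)
    sup (here refl) = ∈-map⁺ toℕ (∈-elements⁺ (complete (inj₁ refl)))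
    sup (there x∈) with ∈-spinePoints⁻ t ws x∈
    ... | lo , hi , A with toFin {M} (≤-trans hi (subst (leaves (comb t ws) ≤_) width (leaves-comb≥ (comb t ws) us)))
    ...   | i , refl = ∈-map⁺ toℕ (∈-elements⁺ (complete (inj₂ (lo , hi , arc-comb us A))))

module FromBlueprint {k M : ℕ} (0<k : 0 < k) (B : Blueprint k M) where

  triangulation : Triangulation {M} (TreeChord (wholeTree B))
  triangulation = tree-triangulation (wholeTree B) (leaves-whole B)

  private
    base-in : ∃ λ (p : Fin (suc M)) → toℕ p ≡ leaves (base B)
    base-in = toFin (≤-trans (leaves-comb≥ (base B) (inner B))
      (subst (leaves (polygonTree B) ≤_) (leaves-whole B) (leaves-comb≥ (polygonTree B) (outer B))))

    polygon-in : ∃ λ (b : Fin (suc M)) → toℕ b ≡ leaves (polygonTree B)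
    polygon-in = toFin (subst (leaves (polygonTree B) ≤_) (leaves-whole B) (leaves-comb≥ (polygonTree B) (outer B)))

    nonempty : ∀ t ws → 0 < length ws → leaves t < leaves (comb t ws)
    nonempty t (w ∷ ws) _ = leaves-comb> t w ws

  p b : Fin (suc M)
  p = proj₁ base-in
  b = proj₁ polygon-in

  p≡ : toℕ p ≡ leaves (base B)
  p≡ = proj₂ base-in

  b≡ : toℕ b ≡ leaves (polygonTree B)
  b≡ = proj₂ polygon-in

  zp : TreeChord (wholeTree B) zero p
  zp = arc-comb (outer B) (arc-comb (inner B) (whole p≡))

  zb : TreeChord (wholeTree B) zero b
  zb = arc-comb (outer B) (whole b≡)

  p<b : p ≺ b
  p<b = subst₂ _<_ (sym p≡) (sym b≡) (nonempty (base B) (inner B)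
    (subst (0 <_) (sym (length-inner B)) (≤-trans 0<k (m≤m+n k (k + 0)))))

  open Build triangulation zp zb p<b public

  R-size : ∣ R ∣ ≡ 2 * k + 2
  R-size = begin
    ∣ R ∣                 ≡⟨ corner-count (base B) (inner B) (outer B) (leaves-whole B) R
                              (λ x∈ → relabel (∈-subset⁻ corner? x∈)) (λ c → ∈-subset⁺ corner? (unlabel c)) ⟩
    2 + length (inner B)  ≡⟨ cong (2 +_) (length-inner B) ⟩
    2 + 2 * k             ≡⟨ +-comm 2 (2 * k) ⟩
    2 * k + 2             ∎
    where
    open ≡-Reasoning
    relabel : ∀ {x} → Corner x → IsCorner (base B) (inner B) (outer B) x
    relabel (inj₁ e) = inj₁ e
    relabel {x} (inj₂ (lo , hi , A)) = inj₂ (subst (_≤ toℕ x) p≡ lo , subst (toℕ x ≤_) b≡ hi , A)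
    unlabel : ∀ {x} → IsCorner (base B) (inner B) (outer B) x → Corner x
    unlabel (inj₁ e) = inj₁ e
    unlabel {x} (inj₂ (lo , hi , A)) = inj₂ (subst (_≤ toℕ x) (sym p≡) lo , subst (toℕ x ≤_) (sym b≡) hi , A)

  built : MarkedDiss (2 * k + 2) (suc M)
  built = marked R-size

-- Blueprints correspond to marked dissections up to rotation

module _ {k M : ℕ} (0<k : 0 < k) where

  build : Blueprint k M → MarkedDiss (2 * k + 2) (suc M)
  build B = FromBlueprint.built 0<k B

  private
    -- So the polygon is never mistaken for one of the triangles.
    4≤r : 4 ≤ 2 * k + 2
    4≤r = +-monoˡ-≤ 2 (*-monoʳ-≤ 2 0<k)

  module _ (B B′ : Blueprint k M) where

    private
      module F = FromBlueprint 0<k B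
      module G = FromBlueprint 0<k B′

    -- Kept chords are shared as edges, deleted ones because they run from 0 to the shared corners.
    -- So the arcs of the two trees do not cross and the trees agree; equal `b` and equal first
    -- corners then fix the two cuts.
    same-trees : (∀ i j → D F.dissection i j ≡ D G.dissection i j) → F.b ≡ G.b →
      (∀ {x} → x ∈ F.R → x ∈ G.R) → (∀ {x} → x ∈ G.R → x ∈ F.R) → SameTrees B B′
    same-trees sameD b≡b′ F⊆G G⊆F with comb-injective (outer B) (outer B′)
        (trans (sym F.b≡) (trans (cong toℕ b≡b′) G.b≡)) whole≡
      where
      chord : ∀ {i j} → TreeChord (wholeTree B) i j → TreeChord (wholeTree B′) i j
      chord {i} {j} ij = byCut ((i Fin.≟ zero) ×-dec ((toℕ F.p <? toℕ j) ×-dec (toℕ j <? toℕ F.b)))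
        where
        i<j : i ≺ j
        i<j = Triangulation.ordered F.triangulation ij
        byCut : Dec (F.Cut i j) → TreeChord (wholeTree B′) i j
        byCut (no ¬cut) = proj₁ (G.edge⇒chord i<j ([ inj₁ , inj₂ ∘ subst T (sameD i j) ]′ (F.chord⇒edge ij ¬cut)))
        byCut (yes (refl , p<j , j<b)) = proj₂ (proj₂ (G.∈R⁻ (F⊆G (F.∈R (<⇒≤ p<j) (<⇒≤ j<b) ij)) i<j))
      inFin : ∀ {x y} (B : Blueprint k M) → Arc (wholeTree B) 0 x y →
        ∃ λ (i : Fin (suc M)) → ∃ λ (j : Fin (suc M)) → toℕ i ≡ x × toℕ j ≡ y
      inFin {x} {y} B A with arc-bounds A
      ... | _ , x<y , y≤ with subst (y ≤_) (leaves-whole B) y≤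
      ...   | y≤M with toFin (≤-trans (<⇒≤ x<y) y≤M) | toFin y≤M
      ...     | i , e | j , e′ = i , j , e , e′
      noncross : ∀ {i j p q} → Arc (wholeTree B) 0 i j → Arc (wholeTree B′) 0 p q →
        ¬ (i < p × p < j × j < q) × ¬ (p < i × i < q × q < j)
      noncross ij pq with inFin B ij
      ... | i , j , refl , refl = arc-noncrossing (chord ij) pq , arc-noncrossing pq (chord ij)
      whole≡ : wholeTree B ≡ wholeTree B′
      whole≡ = tree-unique (wholeTree B) (wholeTree B′) (trans (leaves-whole B) (sym (leaves-whole B′))) noncross
    ... | polygon≡ , outer≡ with comb-injective (inner B) (inner B′)
        (trans (sym F.p≡) (trans (≤-antisym (proj₁ (F.∈R⁻ (G⊆F G.p∈R) G.z<p)) (proj₁ (G.∈R⁻ (F⊆G F.p∈R) F.z<p))) G.p≡))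
        polygon≡
    ...   | base≡ , inner≡ = base≡ , inner≡ , outer≡

    -- Pulling `build B′` back along the rotation gives the diagonals of `build B`. The pulled-back
    -- polygon is a face too large for a triangle, so it is the polygon of `B`.
    build-injective : build B ≈rot build B′ → SameTrees B B′
    build-injective (t , eqD , samePair) with rotateBy t (build B′)
    ... | X , rotX = byPair samePair
      where
      agree : ∀ i j → D (diss X) i j ≡ D F.dissection i j
      agree i j = trans (sameD rotX i j) (eqD i j)
      rgon≡ : rgon X ≡ F.R
      rgon≡ with F.R-others (rgon X) (face-cong {Δ = diss X} {F.dissection} agree (rgon-face X))
      ... | inj₁ three = contradiction (subst (4 ≤_) (trans (sym (rgon-size X)) three) 4≤r) 1+n≰n
      ... | inj₂ e = e
      R⇒ : ∀ {x} → x ∈ F.R → rotBy t x ∈ G.R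
      R⇒ {x} x∈ = rgon⇒ rotX (subst (x ∈_) (sym rgon≡) x∈)
      R⇐ : ∀ {x} → rotBy t x ∈ G.R → x ∈ F.R
      R⇐ {x} x∈ = subst (x ∈_) rgon≡ (rgon⇐ rotX x∈)
      byPair : SamePair (rotBy t zero) (rotBy t F.b) zero G.b → SameTrees B B′
      byPair (inj₁ (z≡ , b≡)) = same-trees
        (λ i j → trans (sym (eqD i j)) (cong₂ (D G.dissection) (fixed i) (fixed j)))
        (trans (sym (fixed F.b)) b≡)
        (λ {x} x∈ → subst (_∈ G.R) (fixed x) (R⇒ x∈))
        (λ {x} x∈ → R⇐ (subst (_∈ G.R) (sym (fixed x)) x∈))
        where fixed = rotBy-identity t z≡
      -- With swapped ends the corner `F.p` would land beyond `G.b`, yet it must land in `G.R`.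
      byPair (inj₂ (z≡b′ , b≡0)) = contradiction
        (subst (_≺ rotBy t F.p) z≡b′ (rotBy-beyond t F.b (subst (zero ≺_) (sym z≡b′) G.z<b) b≡0 F.p F.z<p F.p<b))
        (≤⇒≯ (proj₂ (G.R≼b _ (R⇒ F.p∈R))))

  -- Two cuts on the left spine, at `e₂ X` and at the first corner after 0, give the blueprint. The
  -- claim covers every `B′` with these trees because parking functions reach a blueprint only up to
  -- `SameTrees`.
  build-canonical : (X : MarkedDiss (2 * k + 2) (suc M)) → Canonical X → ∃ λ B → ∀ B′ → SameTrees B′ B →
    (∀ i j → D (diss X) i j ≡ D (diss (build B′)) i j) × e₁ X ≡ e₁ (build B′) × e₂ X ≡ e₂ (build B′)
  build-canonical X can
    with triangulation-tree (FromCanonical.triangulation X can)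
           (<-≤-trans (FromCanonical.z<b X can) (≤-pred (Fin.toℕ<n (e₂ X))))
  ... | t , width-t , t⇒A , A⇒t with comb-split t (A⇒t (FromCanonical.chord-zb X can))
  ...   | u , us , refl , u≡b with comb-split u (arc-uncomb us (A⇒t (FromCanonical.chord-zp X can))
                                  (subst (toℕ (FromCanonical.p X can) ≤_) (sym u≡b) (<⇒≤ (FromCanonical.p<b X can))))
  ...     | v , ws , refl , v≡p = B , agreement
    where
    module C = FromCanonical X can
    size : ∣ C.R ∣ ≡ 2 + length ws
    size = corner-count v ws us width-t C.R
      (λ {x} x∈ → relabel (C.∈R⇒corner x∈)) (λ {x} c → C.corner⇒∈R (unlabel c))
      where
      relabel : ∀ {x} → x ≡ zero ⊎ (C.p ≼ x × x ≼ C.b × C.A zero x) → IsCorner v ws us x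
      relabel (inj₁ e) = inj₁ e
      relabel {x} (inj₂ (lo , hi , A)) = inj₂ (subst (_≤ toℕ x) (sym v≡p) lo , subst (toℕ x ≤_) (sym u≡b) hi , A⇒t A)
      unlabel : ∀ {x} → IsCorner v ws us x → x ≡ zero ⊎ (C.p ≼ x × x ≼ C.b × C.A zero x)
      unlabel (inj₁ e) = inj₁ e
      unlabel {x} (inj₂ (lo , hi , A)) = inj₂ (subst (_≤ toℕ x) v≡p lo , subst (toℕ x ≤_) u≡b hi , t⇒A A)
    B : Blueprint k M
    B = blueprint v ws us (+-cancelˡ-≡ 2 _ _ (trans (sym size) (trans (rgon-size X) (+-comm (2 * k) 2)))) width-t
    agreement : ∀ B′ → SameTrees B′ B →
      (∀ i j → D (diss X) i j ≡ D (diss (build B′)) i j) × e₁ X ≡ e₁ (build B′) × e₂ X ≡ e₂ (build B′)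
    agreement B′@(blueprint .v .ws .us _ _) (refl , refl , refl) = sameD′ , C.e₁≡0 , b≡
      where
      module F = FromBlueprint 0<k B′
      p≡ : toℕ C.p ≡ toℕ F.p
      p≡ = trans (sym v≡p) (sym F.p≡)
      b≡ : C.b ≡ F.b
      b≡ = Fin.toℕ-injective (trans (sym u≡b) (sym F.b≡))
      keep : ∀ {i j} → (C.A i j × ¬ Side i j × ¬ (i ≡ zero × C.p ≺ j × j ≺ C.b)) → F.Kept i j
      keep {i} {j} (A , ¬s , ¬cut) = A⇒t A , ¬s ,
        λ (e , lo , hi) → ¬cut (e , subst (_< toℕ j) (sym p≡) lo , subst (toℕ j <_) (sym (cong toℕ b≡)) hi)
      unkeep : ∀ {i j} → F.Kept i j → (C.A i j × ¬ Side i j × ¬ (i ≡ zero × C.p ≺ j × j ≺ C.b))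
      unkeep {i} {j} (A , ¬s , ¬cut) = t⇒A A , ¬s ,
        λ (e , lo , hi) → ¬cut (e , subst (_< toℕ j) p≡ lo , subst (toℕ j <_) (cong toℕ b≡) hi)
      sameD′ : ∀ i j → D (diss X) i j ≡ D F.dissection i j
      sameD′ i j = T-ext
        (λ d → fromWitness {a? = F.diag? i j} ([ inj₁ ∘ keep , inj₂ ∘ keep ]′ (C.D⇒diag d)))
        (λ d → C.diag⇒D ([ inj₁ ∘ unkeep , inj₂ ∘ unkeep ]′ (toWitness {a? = F.diag? i j} d)))

  build-surjective : ∀ d → ∃ λ B → ∀ B′ → SameTrees B′ B → build B′ ≈rot d
  build-surjective d with canonize d
  ... | t , X , rotX , can with build-canonical X can
  ...   | B , agree = B , λ B′ same → let sameD′ , e₁≡ , e₂≡ = agree B′ same in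
          t , (λ i j → trans (sym (sameD rotX i j)) (sameD′ i j)) ,
          subst₂ (λ x y → SamePair (rotBy t x) (rotBy t y) (e₁ d) (e₂ d)) e₁≡ e₂≡ (sameEdge rotX)

-- Written by fields and not by transport, so that the trees are unchanged by definition.
resize : ∀ {k N M} → N ≡ M → Blueprint k N → Blueprint k M
resize eq B = blueprint (base B) (inner B) (outer B) (length-inner B) (trans (leaves-whole B) eq)

theorem6p3 : (k n : ℕ) → 1 ≤ k → 1 ≤ n →
    Σ (DescStrictNaples k n → MarkedDiss (2 * k + 2) (n + k + 1)) λ f →
    (∀ x y → f x ≈rot f y → proj₁ x ≡ proj₁ y)
    × (∀ d → ∃ λ x → f x ≈rot d)
theorem6p3 (suc k) (suc n) 1≤k _ = f ,
  (λ x y e → strictBlueprint-injective k n x y (build-injective 1≤k (toB x) (toB y) e)) ,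
  λ d → let B , near = build-surjective 1≤k d
            x , same = strictBlueprint-surjective k n (resize (sym size) B)
        in x , near (toB x) same
  where
  -- The number of leaves is rewritten so that its successor is, by definition, the number of
  -- vertices in the statement.
  size : suc n + suc k ≡ n + suc k + 1
  size = +-comm 1 (n + suc k)
  toB : DescStrictNaples (suc k) (suc n) → Blueprint (suc k) (n + suc k + 1)
  toB x = resize size (strictBlueprint k n x)
  f : DescStrictNaples (suc k) (suc n) → MarkedDiss (2 * suc k + 2) (suc n + suc k + 1)
  f x = build 1≤k (toB x)
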